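{- For every integer $t\ge 1$ there is a constant $c_t$ such that $\tau(\mathcal{H})\le c_t\cdot \nu(\mathcal{H})$ for every graph $G$ with no $K_t$-minor and every ball hypergraph $\mathcal{H}$ of $G$.
   Context: Graphs are finite. A hypergraph $\mathcal{H}=(V,\mathcal{E})$ has vertex set $V$ and edge set $\mathcal{E}\subseteq 2^V$. A matching is a set of pairwise vertex-disjoint edges; $\nu(\mathcal{H})$ is the maximum number of edges in a matching. A transversal is a set of vertices meeting every edge; $\tau(\mathcal{H})$ is the minimum size of a transversal. For a graph $G$, an integer $r\ge 0$ and a vertex $v$, the ball $B_r(v)=\{u\in V(G): d_G(u,v)\le r\}$, where $d_G$ is the shortest-path distance in $G$. A ball hypergraph of $G$ is a hypergraph with vertex set $V(G)$ each of whose edges is a ball $B_r(v)$ of $G$ for some integer $r\ge 0$ and some vertex $v$. -}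

module Defs where

open import Data.Nat using (ℕ; zero; suc; _≤_; _*_)
open import Data.Fin using (Fin)
open import Data.Maybe using (Maybe; just)
open import Data.List using (List; length)
open import Data.List.Membership.Propositional using (_∈_)
open import Data.List.Relation.Unary.AllPairs using (AllPairs)
open import Data.Product using (Σ; ∃; ∃-syntax; _×_; _,_)
open import Data.Unit using (⊤)
open import Relation.Nullary using (¬_)
open import Relation.Binary.PropositionalEquality using (_≡_)

record Graph : Set₁ where
  field
    n     : ℕ
    Adj   : Fin n → Fin n → Set
    sym   : ∀ {u v} → Adj u v → Adj v u
    irrefl : ∀ {u} → ¬ Adj u u

module _ (G : Graph) where
  open Graph G

  data WalkIn (P : Fin n → Set) : Fin n → Fin n → ℕ → Set where
    stop : ∀ {u} → P u → WalkIn P u u 0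
    step : ∀ {u w v ℓ} → P u → Adj u w → WalkIn P w v ℓ → WalkIn P u v (suc ℓ)

  DistLe : Fin n → Fin n → ℕ → Set
  DistLe u v r = ∃[ ℓ ] (ℓ ≤ r × WalkIn (λ _ → ⊤) u v ℓ)

  InBall : ℕ → Fin n → Fin n → Set
  InBall r v x = DistLe x v r

  -- G has a K_t minor: branch sets given by a partial assignment
  -- β : V → Maybe (Fin t) (so branch sets are pairwise disjoint), each
  -- branch set nonempty and connected (in the induced subgraph), and
  -- any two distinct branch sets joined by an edge.
  HasMinorK : ℕ → Set
  HasMinorK t = Σ (Fin n → Maybe (Fin t)) λ β →
      (∀ i → ∃[ x ] (β x ≡ just i))
    × (∀ i x y → β x ≡ just i → β y ≡ just i →
         ∃[ ℓ ] WalkIn (λ z → β z ≡ just i) x y ℓ)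
    × (∀ i j → ¬ i ≡ j → ∃[ x ] ∃[ y ] (β x ≡ just i × β y ≡ just j × Adj x y))

-- A ball hypergraph of G: finitely many edges, edge k being the ball
-- B_{radius k}(centre k).
record BallHypergraph (G : Graph) : Set where
  field
    m      : ℕ
    centre : Fin m → Fin (Graph.n G)
    radius : Fin m → ℕ

module _ {G : Graph} (H : BallHypergraph G) where
  open Graph G
  open BallHypergraph H

  _∈E_ : Fin n → Fin m → Set
  x ∈E k = InBall G (radius k) (centre k) x

  Disjoint : Fin m → Fin m → Set
  Disjoint k l = ∀ x → ¬ (x ∈E k × x ∈E l)

  IsMatching : List (Fin m) → Set
  IsMatching M = AllPairs Disjoint M

  IsTransversal : List (Fin n) → Set
  IsTransversal T = ∀ k → ∃[ x ] (x ∈ T × x ∈E k)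

  IsNu : ℕ → Set
  IsNu k = (∃[ M ] (IsMatching M × length M ≡ k))
         × (∀ M → IsMatching M → length M ≤ k)

  IsTau : ℕ → Set
  IsTau k = (∃[ T ] (IsTransversal T × length T ≡ k))
          × (∀ T → IsTransversal T → k ≤ length T)

{-# OPTIONS --safe #-}

-- Given finitely many sites with additive weights, contracting their Voronoi cells gives a minor of
-- G, so the adjacency graph D of the cells has linearly many edges. If v and s are fixed, every site
-- at weighted distance at most s from v, except the one whose cell contains v, is D-adjacent to
-- another such site that is closer to v. Hence among N balls (none containing another), or among N
-- vertices, there are only O(N) exclusive pairs: two balls sharing a vertex that lies in none of
-- the other balls, or two vertices sharing a ball that contains none of the other vertices.
--
-- Multiplicative weights yield either a weighting of the balls with large total weight and small
-- load at every vertex, or a weighting μ of the vertices for which every ball has measure at least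
-- a fraction 1/O(ν) of the total. In the first case, sampling balls at random shows that few pairs
-- of balls meet, and a Turán argument gives a matching of more than ν balls. In the second case,
-- sampling vertices shows that for every fixed ρ a bounded number of vertices hits all balls of
-- relative measure 1/ρ. Choose greedily, by increasing measure, balls that pairwise overlap in a
-- small fraction of their measure: by the sparsity of D their total measure is at most twice that
-- of V(G), so there are O(ν) of them, and every ball is hit by a net of bounded size placed inside
-- a suitable chosen ball (this is the argument of Pyrga and Ray for linear-size ε-nets).
module Submission where

open import Defs
open import Data.Empty using (⊥; ⊥-elim)
open import Data.Fin using (Fin; zero; suc; toℕ)
import Data.Fin.Properties as Fin
open import Data.List using (List; []; _∷_; _++_; length; filter; tabulate; allFin; concatMap)
import Data.List as List
open import Data.List.Membership.Propositional using (_∈_; find; lose)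
open import Data.List.Membership.Propositional.Properties
  using (∈-∃++; ∈-filter⁺; ∈-filter⁻; ∈-allFin; ∈-++⁺ˡ; ∈-++⁺ʳ; ∈-++⁻; ∈-lookup; ∈-tabulate⁺; ∈-concatMap⁺)
import Data.List.Properties as List
open import Data.List.Relation.Unary.All as All using (All; []; _∷_)
import Data.List.Relation.Unary.All.Properties as All
open import Data.List.Relation.Unary.AllPairs as AllPairs using (AllPairs; []; _∷_)
import Data.List.Relation.Unary.AllPairs.Properties as AllPairs
open import Data.List.Relation.Unary.Any as Any using (Any; here; there)
import Data.List.Relation.Unary.Any.Properties as Any
import Data.List.Sort as Sort
open import Data.List.Relation.Unary.Linked.Properties using (Linked⇒AllPairs)
import Data.List.Relation.Binary.Permutation.Propositional as ↭
import Data.List.Relation.Binary.Permutation.Propositional.Properties as ↭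
open import Data.Maybe using (Maybe; just; nothing)
import Data.Maybe as Maybe
open import Data.Nat using (ℕ; zero; suc; _+_; _*_; _∸_; _^_; _⊓_; _≤_; _<_; z≤n; s≤s; _≤?_; _<?_; >-nonZero)
open import Data.Nat.Properties hiding (_≟_)
open import Data.Nat.Tactic.RingSolver using (solve-∀)
open import Data.Product using (Σ; ∃; ∃-syntax; _×_; _,_; proj₁; proj₂)
open import Data.Sum using (_⊎_; inj₁; inj₂) renaming ([_,_] to either)
open import Data.Unit using (⊤; tt)
open import Data.Vec using (Vec; []; _∷_; lookup; _[_]≔_)
open import Data.Vec.Properties using (lookup∘update; lookup∘update′)
open import Function using (_∘_; id)
import Relation.Binary.Construct.On as On
import Relation.Binary.Construct.Flip.EqAndOrd as Flip
open import Relation.Binary.PropositionalEquality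
open import Relation.Nullary using (¬_; Dec; yes; no; ¬?; _×-dec_; _⊎-dec_; _→-dec_; contradiction)
open import Relation.Nullary.Decidable using (map′; decidable-stable; ¬¬-excluded-middle)
open import Algebra.Properties.Semiring.Sum +-*-semiring
  using (sum; sum-cong-≗; ∑-distrib-+; ∑-comm; *-distribˡ-sum; *-distribʳ-sum)

-- Indicators and finite sums.

𝟙 : {P : Set} → Dec P → ℕ
𝟙 (yes _) = 1
𝟙 (no _)  = 0

𝟙≤1 : {P : Set} (p : Dec P) → 𝟙 p ≤ 1
𝟙≤1 (yes _) = ≤-refl
𝟙≤1 (no _)  = z≤n

𝟙-yes : {P : Set} (p : Dec P) → P → 𝟙 p ≡ 1
𝟙-yes (yes _) _ = refl
𝟙-yes (no ¬p) p = contradiction p ¬p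

𝟙-no : {P : Set} (p : Dec P) → ¬ P → 𝟙 p ≡ 0
𝟙-no (yes p) ¬p = contradiction p ¬p
𝟙-no (no _)  _  = refl

𝟙-cover : {P : Set} (p : Dec P) {n : ℕ} → (P → 1 ≤ n) → 𝟙 p ≤ n
𝟙-cover (yes p) f = f p
𝟙-cover (no _)  _ = z≤n

𝟙-mono : {P Q : Set} (p : Dec P) (q : Dec Q) → (P → Q) → 𝟙 p ≤ 𝟙 q
𝟙-mono p q f = 𝟙-cover p λ x → ≤-reflexive (sym (𝟙-yes q (f x)))

𝟙-cong : {P Q : Set} (p : Dec P) (q : Dec Q) → (P → Q) → (Q → P) → 𝟙 p ≡ 𝟙 q
𝟙-cong p q f g = ≤-antisym (𝟙-mono p q f) (𝟙-mono q p g)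

𝟙-× : {P Q : Set} (p : Dec P) (q : Dec Q) → 𝟙 (p ×-dec q) ≡ 𝟙 p * 𝟙 q
𝟙-× (yes _) (yes _) = refl
𝟙-× (yes _) (no _)  = refl
𝟙-× (no _)  _       = refl

sum-mono : ∀ {n} {f g : Fin n → ℕ} → (∀ i → f i ≤ g i) → sum f ≤ sum g
sum-mono {zero}  _ = z≤n
sum-mono {suc n} h = +-mono-≤ (h zero) (sum-mono (h ∘ suc))

sum-const : ∀ n c → sum {n} (λ _ → c) ≡ n * c
sum-const zero    c = refl
sum-const (suc n) c = cong (c +_) (sum-const n c)

term≤sum : ∀ {n} (f : Fin n → ℕ) i → f i ≤ sum f
term≤sum f zero    = m≤m+n _ _
term≤sum f (suc i) = ≤-trans (term≤sum (f ∘ suc) i) (m≤n+m _ _)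

sum-positive : ∀ {n} {f : Fin n → ℕ} → 1 ≤ sum f → ∃[ i ] 1 ≤ f i
sum-positive {suc n} {f} h with f zero in eq
... | suc _ = zero , subst (1 ≤_) (sym eq) (s≤s z≤n)
... | zero  = let i , h′ = sum-positive h in suc i , h′

sum-unique≤1 : ∀ {n} {P : Fin n → Set} (p : ∀ i → Dec (P i)) →
  (∀ {i j} → P i → P j → i ≡ j) → sum (λ i → 𝟙 (p i)) ≤ 1
sum-unique≤1 {zero}  p u = z≤n
sum-unique≤1 {suc n} p u with p zero
... | no _   = sum-unique≤1 (p ∘ suc) λ x y → Fin.suc-injective (u x y)
... | yes p₀ = s≤s (≤-trans (sum-mono none) (≤-reflexive (trans (sum-const n 0) (*-zeroʳ n))))
  where
  none : ∀ i → 𝟙 (p (suc i)) ≤ 0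
  none i = 𝟙-cover (p (suc i)) λ q → contradiction (u p₀ q) λ ()

sum-≢ : ∀ {n} (i : Fin n) → n ≤ suc (sum (λ j → 𝟙 (¬? (i Fin.≟ j))))
sum-≢ {n} i = begin
  n                                                               ≡⟨ trans (sym (*-identityʳ n)) (sym (sum-const n 1)) ⟩
  sum {n} (λ _ → 1)                                               ≤⟨ sum-mono split ⟩
  sum (λ j → 𝟙 (i Fin.≟ j) + 𝟙 (¬? (i Fin.≟ j)))                  ≡⟨ ∑-distrib-+ (λ j → 𝟙 (i Fin.≟ j)) _ ⟩
  sum (λ j → 𝟙 (i Fin.≟ j)) + sum (λ j → 𝟙 (¬? (i Fin.≟ j)))      ≤⟨ +-monoˡ-≤ _ (sum-unique≤1 (i Fin.≟_) λ x y → trans (sym x) y) ⟩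
  suc (sum (λ j → 𝟙 (¬? (i Fin.≟ j))))                            ∎
  where
  open ≤-Reasoning
  split : ∀ j → 1 ≤ 𝟙 (i Fin.≟ j) + 𝟙 (¬? (i Fin.≟ j))
  split j with i Fin.≟ j
  ... | yes _ = ≤-refl
  ... | no _  = ≤-refl

sum₂ : ∀ {m n} → (Fin m → Fin n → ℕ) → ℕ
sum₂ f = sum λ i → sum (f i)

sum₂-mono : ∀ {m n} {f g : Fin m → Fin n → ℕ} → (∀ i j → f i j ≤ g i j) → sum₂ f ≤ sum₂ g
sum₂-mono h = sum-mono λ i → sum-mono (h i)

sum₂-distrib-+ : ∀ {m n} (f g : Fin m → Fin n → ℕ) →
  sum₂ (λ i j → f i j + g i j) ≡ sum₂ f + sum₂ g
sum₂-distrib-+ f g =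
  trans (sum-cong-≗ λ i → ∑-distrib-+ (f i) (g i)) (∑-distrib-+ (λ i → sum (f i)) _)

*-distribˡ-sum₂ : ∀ {m n} c (f : Fin m → Fin n → ℕ) → c * sum₂ f ≡ sum₂ (λ i j → c * f i j)
*-distribˡ-sum₂ c f = trans (*-distribˡ-sum c λ i → sum (f i)) (sum-cong-≗ λ i → *-distribˡ-sum c (f i))

minimiser : ∀ {n} (f : Fin n → ℕ) → Fin n → ∃[ k ] ∀ j → f k ≤ f j
minimiser {suc zero}    f _ = zero , λ { zero → ≤-refl }
minimiser {suc (suc n)} f _ with minimiser (f ∘ suc) zero
... | k , h with f zero ≤? f (suc k)
...   | yes le = zero , λ { zero → ≤-refl ; (suc j) → ≤-trans le (h j) }
...   | no  gt = suc k , λ { zero → <⇒≤ (≰⇒> gt) ; (suc j) → h j }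

Σˡ : {B : Set} → (B → ℕ) → List B → ℕ
Σˡ f []      = 0
Σˡ f (x ∷ l) = f x + Σˡ f l

Σˡ-mono : {B : Set} {f g : B → ℕ} (l : List B) → (∀ x → f x ≤ g x) → Σˡ f l ≤ Σˡ g l
Σˡ-mono []      h = z≤n
Σˡ-mono (x ∷ l) h = +-mono-≤ (h x) (Σˡ-mono l h)

Σˡ-+ : {B : Set} (f g : B → ℕ) (l : List B) → Σˡ (λ x → f x + g x) l ≡ Σˡ f l + Σˡ g l
Σˡ-+ f g []      = refl
Σˡ-+ f g (x ∷ l) rewrite Σˡ-+ f g l = interchange (f x) (g x) _ _
  where
  interchange : ∀ a b c d → (a + b) + (c + d) ≡ (a + c) + (b + d)
  interchange = solve-∀

Σˡ-++ : {B : Set} (f : B → ℕ) (xs : List B) {ys : List B} → Σˡ f (xs ++ ys) ≡ Σˡ f xs + Σˡ f ys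
Σˡ-++ f []       = refl
Σˡ-++ f (x ∷ xs) = trans (cong (f x +_) (Σˡ-++ f xs)) (sym (+-assoc (f x) _ _))

Σˡ-delete : {B : Set} (f : B → ℕ) (xs : List B) {a : B} {ys : List B} →
  Σˡ f (xs ++ a ∷ ys) ≡ f a + Σˡ f (xs ++ ys)
Σˡ-delete f xs {a} {ys} rewrite Σˡ-++ f xs {a ∷ ys} | Σˡ-++ f xs {ys} = swap (Σˡ f xs) (f a) _
  where
  swap : ∀ x y z → x + (y + z) ≡ y + (x + z)
  swap = solve-∀

Σˡ-average : {B : Set} (f : B → ℕ) (c : ℕ) (x : B) (l : List B) →
  Σˡ f (x ∷ l) ≤ c * length (x ∷ l) → ∃[ a ] (a ∈ x ∷ l × f a ≤ c)
Σˡ-average f c x l h with f x ≤? c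
... | yes le = x , here refl , le
Σˡ-average f c x [] h | no gt = contradiction (subst₂ _≤_ (+-identityʳ _) (*-identityʳ c) h) gt
Σˡ-average f c x (y ∷ l) h | no gt =
  let a , a∈ , le = Σˡ-average f c y l (+-cancelˡ-≤ (f x) _ _ (begin
        f x + Σˡ f (y ∷ l)        ≤⟨ h ⟩
        c * suc (length (y ∷ l))  ≡⟨ *-suc c _ ⟩
        c + c * length (y ∷ l)    ≤⟨ +-monoˡ-≤ _ (<⇒≤ (≰⇒> gt)) ⟩
        f x + c * length (y ∷ l)  ∎))
  in a , there a∈ , le
  where open ≤-Reasoning

allPairs-lookup : ∀ {B : Set} {R : B → B → Set} → (∀ {a b} → R a b → R b a) → ∀ {S} → AllPairs R S →
  ∀ i j → ¬ i ≡ j → R (List.lookup S i) (List.lookup S j)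
allPairs-lookup s (r ∷ rs) zero    zero    ne = ⊥-elim (ne refl)
allPairs-lookup s (r ∷ rs) zero    (suc j) _  = All.lookup r (∈-lookup j)
allPairs-lookup s (r ∷ rs) (suc i) zero    _  = s (All.lookup r (∈-lookup i))
allPairs-lookup s (r ∷ rs) (suc i) (suc j) ne = allPairs-lookup s rs i j (ne ∘ cong suc)

-- Edge density of families without a complete minor.

-- The recurrence solves to 2^(t+1) - 2. Contracting one edge loses that edge and at most
-- `2 * density t + 1` more through common neighbours.
density : ℕ → ℕ
density zero    = 0
density (suc t) = 2 * density t + 2

module Blobs (G : Graph) (adj? : (u v : Fin (Graph.n G)) → Dec (Graph.Adj G u v)) where
  open Graph G using (n; Adj) renaming (sym to adj-sym)

  -- A list of blobs stands for a graph with adjacency `Touch`, so contracting an edge is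
  -- concatenation and no quotient graph has to be built.
  Blob : Set
  Blob = List (Fin n)

  Touch : Blob → Blob → Set
  Touch a b = Any (λ x → Any (Adj x) b) a

  touch? : ∀ a b → Dec (Touch a b)
  touch? a b = Any.any? (λ x → Any.any? (adj? x) b) a

  touch : ∀ {a b x y} → x ∈ a → y ∈ b → Adj x y → Touch a b
  touch x∈ y∈ xy = lose x∈ (lose y∈ xy)

  touch⁻ : ∀ {a b} → Touch a b → ∃[ x ] ∃[ y ] (x ∈ a × y ∈ b × Adj x y)
  touch⁻ t = let x , x∈ , s = find t ; y , y∈ , xy = find s in x , y , x∈ , y∈ , xy

  touch-sym : ∀ {a b} → Touch a b → Touch b a
  touch-sym t = let _ , _ , x∈ , y∈ , xy = touch⁻ t in touch y∈ x∈ (adj-sym xy)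

  NonEmpty : Blob → Set
  NonEmpty a = ∃[ x ] x ∈ a

  nonEmpty? : ∀ a → Dec (NonEmpty a)
  nonEmpty? []      = no λ ()
  nonEmpty? (x ∷ _) = yes (x , here refl)

  touch⇒nonEmpty : ∀ {a b} → Touch a b → NonEmpty a
  touch⇒nonEmpty t = let x , _ , x∈ , _ = touch⁻ t in x , x∈

  Connected : Blob → Set
  Connected a = ∀ x y → x ∈ a → y ∈ a → ∃[ ℓ ] WalkIn G (_∈ a) x y ℓ

  Disj : Blob → Blob → Set
  Disj a b = ∀ x → x ∈ a → x ∈ b → ⊥

  disj-sym : ∀ {a b} → Disj a b → Disj b a
  disj-sym d x p q = d x q p

  disj-++ : ∀ v a b → Disj v a → Disj v b → Disj v (a ++ b)
  disj-++ v a b p q x x∈v x∈ = either (p x x∈v) (q x x∈v) (∈-++⁻ a x∈)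

  touch-++ˡ : ∀ {a b x} → Touch a x → Touch (a ++ b) x
  touch-++ˡ = Any.++⁺ˡ

  touch-++ʳ : ∀ {a b x} → Touch b x → Touch (a ++ b) x
  touch-++ʳ {a} = Any.++⁺ʳ a

  walk-map : {P Q : Fin n → Set} → (∀ {x} → P x → Q x) →
    ∀ {x y ℓ} → WalkIn G P x y ℓ → WalkIn G Q x y ℓ
  walk-map f (stop p)     = stop (f p)
  walk-map f (step p e w) = step (f p) e (walk-map f w)

  walk-trans : {P : Fin n → Set} → ∀ {x y z k ℓ} →
    WalkIn G P x y k → WalkIn G P y z ℓ → WalkIn G P x z (k + ℓ)
  walk-trans (stop _)     w = w
  walk-trans (step p e v) w = step p e (walk-trans v w)

  walk-start : {P : Fin n → Set} → ∀ {x y ℓ} → WalkIn G P x y ℓ → P x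
  walk-start (stop p)     = p
  walk-start (step p _ _) = p

  walk-rev : {P : Fin n → Set} → ∀ {x y ℓ} → WalkIn G P x y ℓ → WalkIn G P y x ℓ
  walk-rev (stop p) = stop p
  walk-rev (step {ℓ = ℓ} p e w) =
    subst (WalkIn G _ _ _) (+-comm ℓ 1) (walk-trans (walk-rev w) (step (walk-start w) (adj-sym e) (stop p)))

  connected-++ : ∀ {a b} → Touch a b → Connected a → Connected b → Connected (a ++ b)
  connected-++ {a} {b} t ca cb x y x∈ y∈ = connect (∈-++⁻ a x∈) (∈-++⁻ a y∈)
    where
    inl : ∀ {z} → z ∈ a → z ∈ a ++ b
    inl = ∈-++⁺ˡ
    inr : ∀ {z} → z ∈ b → z ∈ a ++ b
    inr = ∈-++⁺ʳ a
    across : ∀ {x y} → x ∈ a → y ∈ b → ∃[ ℓ ] WalkIn G (_∈ a ++ b) x y ℓ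
    across x∈ y∈ =
      let u , w , u∈ , w∈ , uw = touch⁻ t
          _ , p = ca _ u x∈ u∈
          _ , q = cb w _ w∈ y∈
      in _ , walk-trans (walk-map inl p) (step (inl u∈) uw (walk-map inr q))
    connect : ∀ {x y} → x ∈ a ⊎ x ∈ b → y ∈ a ⊎ y ∈ b → ∃[ ℓ ] WalkIn G (_∈ a ++ b) x y ℓ
    connect (inj₁ x∈) (inj₁ y∈) = let _ , w = ca _ _ x∈ y∈ in _ , walk-map inl w
    connect (inj₂ x∈) (inj₂ y∈) = let _ , w = cb _ _ x∈ y∈ in _ , walk-map inr w
    connect (inj₁ x∈) (inj₂ y∈) = across x∈ y∈
    connect (inj₂ x∈) (inj₁ y∈) = let _ , w = across y∈ x∈ in _ , walk-rev w

  Valid : List Blob → Set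
  Valid F = All Connected F × AllPairs Disj F

  -- The last clause says that every blob of the model is a union of blobs of F.
  Model : ℕ → List Blob → Set₁
  Model t F = Σ (List Blob) λ K → length K ≡ t × Valid K × All NonEmpty K × AllPairs Touch K ×
    ((Q : Blob → Set) → (∀ a b → Q a → Q b → Q (a ++ b)) → All Q F → All Q K)

  deg : Blob → List Blob → ℕ
  deg v = Σˡ (λ x → 𝟙 (touch? v x))

  edges : List Blob → ℕ
  edges []      = 0
  edges (v ∷ F) = deg v F + edges F

  -- Empty blobs touch nothing. Counting only the others makes the edge bound apply to subfamilies
  -- obtained by emptying blobs instead of removing them.
  nonEmpties : List Blob → ℕ
  nonEmpties = Σˡ (λ x → 𝟙 (nonEmpty? x))

  deg-comm : ∀ a b → 𝟙 (touch? a b) ≡ 𝟙 (touch? b a)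
  deg-comm a b = 𝟙-cong (touch? a b) (touch? b a) touch-sym touch-sym

  edges-delete : ∀ xs a ys → edges (xs ++ a ∷ ys) ≡ deg a (xs ++ ys) + edges (xs ++ ys)
  edges-delete []       a ys = refl
  edges-delete (x ∷ xs) a ys
    rewrite Σˡ-delete (λ z → 𝟙 (touch? x z)) xs {a} {ys} | edges-delete xs a ys | deg-comm x a =
      shuffle (𝟙 (touch? a x)) (deg x (xs ++ ys)) _ _
    where
    shuffle : ∀ p q r s → (p + q) + (r + s) ≡ (p + r) + (q + s)
    shuffle = solve-∀

  -- The handshake identity, with one extra unit per blob because a blob with an internal edge
  -- touches itself.
  degree-sum : ∀ F → Σˡ (λ a → deg a F) F ≤ 2 * edges F + length F
  degree-sum []      = z≤n
  degree-sum (v ∷ F) = begin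
    𝟙 (touch? v v) + deg v F + Σˡ (λ a → 𝟙 (touch? a v) + deg a F) F
      ≡⟨ cong (𝟙 (touch? v v) + deg v F +_) (Σˡ-+ (λ a → 𝟙 (touch? a v)) (λ a → deg a F) F) ⟩
    𝟙 (touch? v v) + deg v F + (Σˡ (λ a → 𝟙 (touch? a v)) F + Σˡ (λ a → deg a F) F)
      ≤⟨ +-mono-≤ (+-monoˡ-≤ (deg v F) (𝟙≤1 (touch? v v)))
           (+-mono-≤ (Σˡ-mono F λ a → ≤-reflexive (deg-comm a v)) (degree-sum F)) ⟩
    1 + deg v F + (deg v F + (2 * edges F + length F))
      ≡⟨ regroup (deg v F) (edges F) (length F) ⟩
    2 * (deg v F + edges F) + suc (length F) ∎
    where
    open ≤-Reasoning
    regroup : ∀ d e l → 1 + d + (d + (2 * e + l)) ≡ 2 * (d + e) + suc l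
    regroup = solve-∀

  nonEmpties≤length : ∀ F → nonEmpties F ≤ length F
  nonEmpties≤length []      = z≤n
  nonEmpties≤length (x ∷ F) = +-mono-≤ (𝟙≤1 (nonEmpty? x)) (nonEmpties≤length F)

  common : Blob → Blob → List Blob → ℕ
  common v a = Σˡ (λ x → 𝟙 (touch? v x ×-dec touch? a x))

  -- Inclusion-exclusion: merging loses one edge for each blob touched by both.
  deg-merge : ∀ v a X → deg v X + deg a X ≤ deg (v ++ a) X + common v a X
  deg-merge v a X = begin
    deg v X + deg a X                                        ≡⟨ sym (Σˡ-+ (λ x → 𝟙 (touch? v x)) _ X) ⟩
    Σˡ (λ x → 𝟙 (touch? v x) + 𝟙 (touch? a x)) X             ≤⟨ Σˡ-mono X pointwise ⟩
    Σˡ (λ x → 𝟙 (touch? (v ++ a) x) + 𝟙 (touch? v x ×-dec touch? a x)) X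
                                                             ≡⟨ Σˡ-+ (λ x → 𝟙 (touch? (v ++ a) x)) _ X ⟩
    deg (v ++ a) X + common v a X                            ∎
    where
    open ≤-Reasoning
    pointwise : ∀ x → 𝟙 (touch? v x) + 𝟙 (touch? a x)
                    ≤ 𝟙 (touch? (v ++ a) x) + 𝟙 (touch? v x ×-dec touch? a x)
    pointwise x with touch? v x | touch? a x
    ... | yes p | yes _ = +-monoˡ-≤ 1 (≤-reflexive (sym (𝟙-yes (touch? (v ++ a) x) (touch-++ˡ p))))
    ... | yes p | no _  = ≤-trans (≤-reflexive (sym (𝟙-yes (touch? (v ++ a) x) (touch-++ˡ p)))) (m≤m+n _ _)
    ... | no _  | yes q = ≤-trans (≤-reflexive (sym (𝟙-yes (touch? (v ++ a) x) (touch-++ʳ {v} q)))) (m≤m+n _ _)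
    ... | no _  | no _  = z≤n

  common-filter : ∀ v a F → common v a F ≡ deg a (filter (touch? v) F)
  common-filter v a []      = refl
  common-filter v a (x ∷ F) with touch? v x
  ... | no _  = common-filter v a F
  ... | yes _ with touch? a x
  ...   | yes _ = cong suc (common-filter v a F)
  ...   | no _  = common-filter v a F

  deg-none : ∀ v F → filter (touch? v) F ≡ [] → deg v F ≡ 0
  deg-none v []      _ = refl
  deg-none v (x ∷ F) h with touch? v x
  ... | no _ = deg-none v F h

  allPairs-delete : ∀ {R : Blob → Blob → Set} → (∀ {a b} → R a b → R b a) → ∀ xs {a ys} →
    AllPairs R (xs ++ a ∷ ys) → AllPairs R (xs ++ ys) × All (R a) (xs ++ ys)
  allPairs-delete s []       (h ∷ hs) = hs , h
  allPairs-delete s (x ∷ xs) (h ∷ hs) with All.++⁻ xs h | allPairs-delete s xs hs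
  ... | h₁ , h₂ ∷ h₃ | ps , q = All.++⁺ h₁ h₃ ∷ ps , s h₂ ∷ q

  all-delete : ∀ {Q : Blob → Set} xs {a ys} → All Q (xs ++ a ∷ ys) → All Q (xs ++ ys) × Q a
  all-delete xs h with All.++⁻ xs h
  ... | h₁ , q ∷ h₂ = All.++⁺ h₁ h₂ , q

  valid-merge : ∀ v xs {a ys} → Touch v a → Valid (v ∷ xs ++ a ∷ ys) → Valid ((v ++ a) ∷ xs ++ ys)
  valid-merge v xs {a} va (cv ∷ cs , dv ∷ ds) =
    let cs′ , ca = all-delete xs cs
        ds′ , da = allPairs-delete disj-sym xs ds
        dv′ , _  = all-delete xs dv
    in connected-++ va cv ca ∷ cs′ ,
       All.zipWith (λ (p , q) → disj-sym (disj-++ _ v a (disj-sym p) (disj-sym q))) (dv′ , da) ∷ ds′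

  nonEmpties-merge : ∀ v xs {a ys} → Touch v a →
    suc (nonEmpties ((v ++ a) ∷ xs ++ ys)) ≤ nonEmpties (v ∷ xs ++ a ∷ ys)
  nonEmpties-merge v xs {a} {ys} va
    rewrite Σˡ-delete (λ x → 𝟙 (nonEmpty? x)) xs {a} {ys}
          | 𝟙-yes (nonEmpty? v) (touch⇒nonEmpty va)
          | 𝟙-yes (nonEmpty? a) (touch⇒nonEmpty (touch-sym va)) =
    s≤s (+-monoˡ-≤ _ (𝟙≤1 (nonEmpty? (v ++ a))))

  -- Touching `v` and being disjoint from `v` both pass to unions, so they pass from the neighbours
  -- of `v` to the blobs of a model built from them.
  model-extend : ∀ {t} v F → NonEmpty v → Valid (v ∷ F) →
    Model t (filter (touch? v) F) → Model (suc t) (v ∷ F)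
  model-extend v F ne (cv ∷ _ , dv ∷ _) (K , len , (cK , dK) , neK , tK , inherit) =
    v ∷ K , cong suc len ,
    (cv ∷ cK , inherit (Disj v) (disj-++ v) (All.filter⁺ (touch? v) dv) ∷ dK) ,
    ne ∷ neK ,
    inherit (Touch v) (λ a b p _ → touch-sym (touch-++ˡ {b = b} (touch-sym p))) (All.all-filter (touch? v) F) ∷ tK ,
    λ { Q cl (q ∷ qs) → q ∷ inherit Q cl (All.filter⁺ (touch? v) qs) }

  -- Contract the first blob v with a neighbour a having few neighbours in common with v; such an a
  -- exists because the neighbourhood of v has no K_t model, hence is sparse by induction on t.
  edges≤⊎model : ∀ t F → Valid F → edges F ≤ density t * nonEmpties F ⊎ Model t F
  edges≤⊎model zero    F val = inj₂ ([] , refl , ([] , []) , [] , [] , λ _ _ _ → [])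
  edges≤⊎model (suc t) F val = go (length F) F ≤-refl val
    where
    open ≤-Reasoning
    go : ∀ ℓ F → length F ≤ ℓ → Valid F → edges F ≤ density (suc t) * nonEmpties F ⊎ Model (suc t) F
    go ℓ       []      len val = inj₁ z≤n
    go (suc ℓ) (v ∷ F) (s≤s len) val@(_ ∷ cs , _ ∷ ds) with filter (touch? v) F in eq
    ... | [] with go ℓ F len (cs , ds)
    ...   | inj₂ (K , l , vK , nK , tK , inh) = inj₂ (K , l , vK , nK , tK , λ { Q cl (_ ∷ qs) → inh Q cl qs })
    ...   | inj₁ le rewrite deg-none v F eq =
      inj₁ (≤-trans le (*-monoʳ-≤ (density (suc t)) (m≤n+m _ (𝟙 (nonEmpty? v)))))
    go (suc ℓ) (v ∷ F) (s≤s len) val@(_ ∷ cs , _ ∷ ds) | x ∷ N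
      with edges≤⊎model t (x ∷ N)
             (subst Valid eq (All.filter⁺ (touch? v) cs , AllPairs.filter⁺ (touch? v) ds))
    ...   | inj₂ m = inj₂ (model-extend v F nev val (subst (Model t) (sym eq) m))
      where
      nev : NonEmpty v
      nev = touch⇒nonEmpty (proj₂ (∈-filter⁻ (touch? v) {xs = F} (subst (x ∈_) (sym eq) (here refl))))
    ...   | inj₁ le
      with Σˡ-average (λ a → deg a (x ∷ N)) (2 * density t + 1) x N (begin
             Σˡ (λ a → deg a (x ∷ N)) (x ∷ N)            ≤⟨ degree-sum (x ∷ N) ⟩
             2 * edges (x ∷ N) + length (x ∷ N)          ≤⟨ +-monoˡ-≤ _ (*-monoʳ-≤ 2 (≤-trans le (*-monoʳ-≤ (density t) (nonEmpties≤length (x ∷ N))))) ⟩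
             2 * (density t * length (x ∷ N)) + length (x ∷ N) ≡⟨ factor (density t) (length (x ∷ N)) ⟩
             (2 * density t + 1) * length (x ∷ N)        ∎)
      where
      factor : ∀ d l → 2 * (d * l) + l ≡ (2 * d + 1) * l
      factor = solve-∀
    ... | a , a∈N , dega with ∈-filter⁻ (touch? v) {xs = F} (subst (a ∈_) (sym eq) a∈N)
    ...   | a∈F , va with ∈-∃++ a∈F
    ...     | xs , ys , refl with go ℓ ((v ++ a) ∷ xs ++ ys) shorter (valid-merge v xs va val)
      where
      shorter : suc (length (xs ++ ys)) ≤ ℓ
      shorter = ≤-trans (≤-reflexive (trans (cong suc (List.length-++ xs)) (trans (sym (+-suc (length xs) _)) (sym (List.length-++ xs))))) len
    ...       | inj₂ (K , l , vK , nK , tK , inh) =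
      inj₂ (K , l , vK , nK , tK , λ { Q cl (q ∷ qs) → let qs′ , qa = all-delete xs qs in inh Q cl (cl v a q qa ∷ qs′) })
    ...       | inj₁ ih = inj₁ (begin
      deg v (xs ++ a ∷ ys) + edges (xs ++ a ∷ ys)
        ≡⟨ cong₂ _+_ (Σˡ-delete (λ z → 𝟙 (touch? v z)) xs) (edges-delete xs a ys) ⟩
      (𝟙 (touch? v a) + deg v X) + (deg a X + edges X)
        ≡⟨ assoc (𝟙 (touch? v a)) (deg v X) (deg a X) (edges X) ⟩
      𝟙 (touch? v a) + (deg v X + deg a X) + edges X
        ≤⟨ +-monoˡ-≤ (edges X) (+-mono-≤ (𝟙≤1 (touch? v a)) (deg-merge v a X)) ⟩
      1 + (deg (v ++ a) X + common v a X) + edges X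
        ≤⟨ +-monoˡ-≤ (edges X) (s≤s (+-monoʳ-≤ (deg (v ++ a) X) commonX)) ⟩
      1 + (deg (v ++ a) X + (2 * density t + 1)) + edges X
        ≡⟨ collect (deg (v ++ a) X) (density t) (edges X) ⟩
      density (suc t) + (deg (v ++ a) X + edges X)
        ≤⟨ +-monoʳ-≤ (density (suc t)) ih ⟩
      density (suc t) + density (suc t) * nonEmpties ((v ++ a) ∷ X)
        ≡⟨ sym (*-suc (density (suc t)) _) ⟩
      density (suc t) * suc (nonEmpties ((v ++ a) ∷ X))
        ≤⟨ *-monoʳ-≤ (density (suc t)) (nonEmpties-merge v xs va) ⟩
      density (suc t) * nonEmpties (v ∷ xs ++ a ∷ ys) ∎)
      where
      X = xs ++ ys
      assoc : ∀ p q r s → (p + q) + (r + s) ≡ p + (q + r) + s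
      assoc = solve-∀
      collect : ∀ p d e → 1 + (p + (2 * d + 1)) + e ≡ (2 * d + 2) + (p + e)
      collect = solve-∀
      -- Common neighbours of `v` and `a` are the neighbours of `a` inside the neighbourhood of `v`,
      -- and `a` was chosen to have few of those.
      commonX : common v a X ≤ 2 * density t + 1
      commonX = begin
        common v a X                            ≤⟨ m≤n+m _ _ ⟩
        𝟙 (touch? v a ×-dec touch? a a) + common v a X ≡⟨ sym (Σˡ-delete (λ z → 𝟙 (touch? v z ×-dec touch? a z)) xs) ⟩
        common v a (xs ++ a ∷ ys)               ≡⟨ common-filter v a (xs ++ a ∷ ys) ⟩
        deg a (filter (touch? v) (xs ++ a ∷ ys)) ≡⟨ cong (deg a) eq ⟩
        deg a (x ∷ N)                           ≤⟨ dega ⟩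
        2 * density t + 1                       ∎

  label : (K : List Blob) → Fin n → Maybe (Fin (length K))
  label []      z = nothing
  label (a ∷ K) z with Any.any? (z Fin.≟_) a
  ... | yes _ = just zero
  ... | no _  = Maybe.map suc (label K z)

  label⁻ : ∀ K {z i} → label K z ≡ just i → z ∈ List.lookup K i
  label⁻ (a ∷ K) {z} eq with Any.any? (z Fin.≟_) a
  label⁻ (a ∷ K) refl | yes p = p
  label⁻ (a ∷ K) {z} eq | no _ with label K z in e
  label⁻ (a ∷ K) refl | no _ | just i = label⁻ K e

  label⁺ : ∀ K {z} → AllPairs Disj K → ∀ i → z ∈ List.lookup K i → label K z ≡ just i
  label⁺ (a ∷ K) {z} (d ∷ ds) i p with Any.any? (z Fin.≟_) a
  label⁺ (a ∷ K) (d ∷ ds) zero    p | yes _ = refl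
  label⁺ (a ∷ K) (d ∷ ds) (suc i) p | yes q = ⊥-elim (All.lookup d (∈-lookup i) _ q p)
  label⁺ (a ∷ K) (d ∷ ds) zero    p | no ¬q = contradiction p ¬q
  label⁺ (a ∷ K) (d ∷ ds) (suc i) p | no _ rewrite label⁺ K ds i p = refl

  model⇒minor : ∀ {t F} → Model t F → HasMinorK G t
  model⇒minor (K , refl , (cK , dK) , neK , tK , _) = label K ,
    (λ i → let x , x∈ = All.lookup neK (∈-lookup i) in x , label⁺ K dK i x∈) ,
    (λ i x y p q →
       let ℓ , w = All.lookup cK (∈-lookup i) x y (label⁻ K p) (label⁻ K q)
       in ℓ , walk-map (label⁺ K dK i) w) ,
    λ i j i≢j →
       let x , y , x∈ , y∈ , xy = touch⁻ (allPairs-lookup touch-sym tK i j i≢j)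
       in x , y , label⁺ K dK i x∈ , label⁺ K dK j y∈ , xy

-- Sparsity of the contact graph of disjoint connected cells.

Σˡ-tabulate : ∀ {B : Set} {N} (g : B → ℕ) (f : Fin N → B) → Σˡ g (tabulate f) ≡ sum (g ∘ f)
Σˡ-tabulate {N = zero}  g f = refl
Σˡ-tabulate {N = suc N} g f = cong (g (f zero) +_) (Σˡ-tabulate g (f ∘ suc))

module SparseCells (G : Graph) (adj? : (u v : Fin (Graph.n G)) → Dec (Graph.Adj G u v))
                   (t : ℕ) (minorFree : ¬ HasMinorK G t) where
  open Blobs G adj?

  ordered-pairs≤edges : ∀ {N} (D : Fin N → Fin N → ℕ) (f : Fin N → Blob) →
    (∀ i → D i i ≡ 0) → (∀ i k → D i k ≤ 𝟙 (touch? (f i) (f k))) →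
    sum₂ D ≤ 2 * edges (tabulate f)
  ordered-pairs≤edges {zero}  D f diag le = z≤n
  ordered-pairs≤edges {suc N} D f diag le = begin
    D zero zero + sum (D zero ∘ suc) + sum (λ i → D (suc i) zero + sum (D (suc i) ∘ suc))
      ≡⟨ cong₂ (λ p q → p + sum (D zero ∘ suc) + q) (diag zero) (∑-distrib-+ (λ i → D (suc i) zero) _) ⟩
    sum (D zero ∘ suc) + (sum (λ i → D (suc i) zero) + sum₂ (λ i k → D (suc i) (suc k)))
      ≤⟨ +-mono-≤ (sum-mono λ k → le zero (suc k))
           (+-mono-≤ (sum-mono λ i → ≤-trans (le (suc i) zero) (≤-reflexive (deg-comm (f (suc i)) (f zero))))
             (ordered-pairs≤edges (λ i k → D (suc i) (suc k)) (f ∘ suc) (diag ∘ suc) λ i k → le (suc i) (suc k))) ⟩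
    d + (d + 2 * edges (tabulate (f ∘ suc)))  ≡⟨ twice d _ ⟩
    2 * (d + edges (tabulate (f ∘ suc)))
      ≡⟨ cong (λ z → 2 * (z + edges (tabulate (f ∘ suc)))) (sym (Σˡ-tabulate (λ x → 𝟙 (touch? (f zero) x)) (f ∘ suc))) ⟩
    2 * edges (tabulate f) ∎
    where
    open ≤-Reasoning
    d = sum (λ k → 𝟙 (touch? (f zero) (f (suc k))))
    twice : ∀ d e → d + (d + 2 * e) ≡ 2 * (d + e)
    twice = solve-∀

  -- Emptying a discarded cell, rather than deleting it, keeps the index set `Fin N`.
  keep : {P : Set} → Dec P → Blob → Blob
  keep (yes _) a = a
  keep (no _)  _ = []

  keep-connected : ∀ {P : Set} (p : Dec P) {a} → Connected a → Connected (keep p a)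
  keep-connected (yes _) c = c
  keep-connected (no _)  _ = λ _ _ ()

  keep-disj : ∀ {P Q : Set} (p : Dec P) (q : Dec Q) {a b} → Disj a b → Disj (keep p a) (keep q b)
  keep-disj (yes _) (yes _) d = d
  keep-disj (yes _) (no _)  _ = λ _ _ ()
  keep-disj (no _)  _       _ = λ _ ()

  module Links {N : ℕ} (cell : Fin N → Blob) (connected : ∀ i → Connected (cell i))
               (disjoint : {i j : Fin N} → ¬ i ≡ j → Disj (cell i) (cell j)) where

    Link : Fin N → Fin N → Set
    Link i j = ¬ i ≡ j × Touch (cell i) (cell j)

    link? : ∀ i j → Dec (Link i j)
    link? i j = ¬? (i Fin.≟ j) ×-dec touch? (cell i) (cell j)

    -- The bound has to hold for every induced subfamily `U`, because `sum-links-min` applies it to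
    -- each level set of a weight function. The factor 2 comes from ordered pairs.
    links-sparse : {U : Fin N → Set} (u? : ∀ i → Dec (U i)) →
      sum₂ (λ i j → 𝟙 (link? i j ×-dec (u? i ×-dec u? j))) ≤ 2 * density t * sum (λ i → 𝟙 (u? i))
    links-sparse {U} u? = begin
      sum₂ (λ i j → 𝟙 (link? i j ×-dec (u? i ×-dec u? j)))
        ≤⟨ ordered-pairs≤edges _ kept diag below ⟩
      2 * edges (tabulate kept)
        ≤⟨ *-monoʳ-≤ 2 sparse ⟩
      2 * (density t * nonEmpties (tabulate kept))
        ≡⟨ cong (λ z → 2 * (density t * z)) (Σˡ-tabulate (λ x → 𝟙 (nonEmpty? x)) kept) ⟩
      2 * (density t * sum (λ i → 𝟙 (nonEmpty? (kept i))))
        ≤⟨ *-monoʳ-≤ 2 (*-monoʳ-≤ (density t) (sum-mono occupied)) ⟩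
      2 * (density t * sum (λ i → 𝟙 (u? i)))
        ≡⟨ sym (*-assoc 2 (density t) _) ⟩
      2 * density t * sum (λ i → 𝟙 (u? i)) ∎
      where
      open ≤-Reasoning
      kept : Fin N → Blob
      kept i = keep (u? i) (cell i)
      diag : ∀ i → 𝟙 (link? i i ×-dec (u? i ×-dec u? i)) ≡ 0
      diag i = 𝟙-no (link? i i ×-dec (u? i ×-dec u? i)) λ ((i≢i , _) , _) → i≢i refl
      below : ∀ i j → 𝟙 (link? i j ×-dec (u? i ×-dec u? j)) ≤ 𝟙 (touch? (kept i) (kept j))
      below i j with u? i | u? j
      ... | yes u | yes w = 𝟙-mono (link? i j ×-dec (yes u ×-dec yes w)) (touch? (cell i) (cell j)) (proj₂ ∘ proj₁)
      ... | yes u | no ¬w = 𝟙-cover (link? i j ×-dec (yes u ×-dec no ¬w)) λ (_ , _ , w) → contradiction w ¬w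
      ... | no ¬u | q     = 𝟙-cover (link? i j ×-dec (no ¬u ×-dec q)) λ (_ , u , _) → contradiction u ¬u
      occupied : ∀ i → 𝟙 (nonEmpty? (kept i)) ≤ 𝟙 (u? i)
      occupied i with u? i
      ... | yes _ = 𝟙≤1 (nonEmpty? (cell i))
      ... | no _  = z≤n
      sparse : edges (tabulate kept) ≤ density t * nonEmpties (tabulate kept)
      sparse with edges≤⊎model t (tabulate kept)
                    (All.tabulate⁺ (λ i → keep-connected (u? i) (connected i)) ,
                     AllPairs.tabulate⁺ λ {i} {j} ne → keep-disj (u? i) (u? j) (disjoint ne))
      ... | inj₁ le = le
      ... | inj₂ m  = contradiction (model⇒minor m) minorFree

-- Distances in G, truncated at R + 1 so that unreachable pairs need no special treatment.
module Distance (G : Graph) (adj? : (u v : Fin (Graph.n G)) → Dec (Graph.Adj G u v)) (R : ℕ) where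
  open Graph G using (n; Adj) renaming (sym to adj-sym)
  open Blobs G adj? using (walk-trans; walk-rev)

  distLe-step : ∀ {u w v r} → Adj u w → DistLe G w v r → DistLe G u v (suc r)
  distLe-step uw (ℓ , le , p) = suc ℓ , s≤s le , step tt uw p

  distLe? : ∀ u v r → Dec (DistLe G u v r)
  distLe? u v zero    = map′ (λ { refl → 0 , z≤n , stop tt }) (λ { (zero , _ , stop _) → refl }) (u Fin.≟ v)
  distLe? u v (suc r) with u Fin.≟ v
  ... | yes refl = yes (0 , z≤n , stop tt)
  ... | no u≢v   = map′ (λ (w , uw , d) → distLe-step uw d)
    (λ { (zero , _ , stop _) → contradiction refl u≢v
       ; (suc ℓ , s≤s le , step _ uw p) → _ , uw , ℓ , le , p })
    (Fin.any? λ w → adj? u w ×-dec distLe? w v r)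

  -- The minimum of `M` and the distance: the value grows until it is a radius that reaches `v`, and
  -- then stays.
  distUpTo : ℕ → Fin n → Fin n → ℕ
  distUpTo zero    u v = 0
  distUpTo (suc M) u v with distLe? u v (distUpTo M u v)
  ... | yes _ = distUpTo M u v
  ... | no _  = suc (distUpTo M u v)

  distUpTo-least : ∀ M {u v r} → r < distUpTo M u v → ¬ DistLe G u v r
  distUpTo-least (suc M) {u} {v} lt with distLe? u v (distUpTo M u v)
  ... | yes _ = distUpTo-least M lt
  ... | no ¬d with m≤n⇒m<n∨m≡n (≤-pred lt)
  ...   | inj₁ lt′ = distUpTo-least M lt′
  ...   | inj₂ refl = ¬d

  distUpTo-reached : ∀ M {u v} → distUpTo M u v < M → DistLe G u v (distUpTo M u v)
  distUpTo-reached (suc M) {u} {v} lt with distLe? u v (distUpTo M u v)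
  ... | yes d = d
  ... | no ¬d = contradiction (distUpTo-reached M (≤-pred lt)) ¬d

  distUpTo≤ : ∀ M u v → distUpTo M u v ≤ M
  distUpTo≤ zero    u v = z≤n
  distUpTo≤ (suc M) u v with distLe? u v (distUpTo M u v)
  ... | yes _ = m≤n⇒m≤1+n (distUpTo≤ M u v)
  ... | no _  = s≤s (distUpTo≤ M u v)

  abstract
    d : Fin n → Fin n → ℕ
    d = distUpTo (suc R)

    d≤R+1 : ∀ u v → d u v ≤ suc R
    d≤R+1 = distUpTo≤ (suc R)

    d≤ : ∀ {u v r} → DistLe G u v r → d u v ≤ r
    d≤ D = ≮⇒≥ λ lt → distUpTo-least (suc R) lt D

    distLe : ∀ {u v r} → r ≤ R → d u v ≤ r → DistLe G u v r
    distLe r≤R le =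
      let ℓ , le′ , w = distUpTo-reached (suc R) (s≤s (≤-trans le r≤R)) in ℓ , ≤-trans le′ le , w

  d-self : ∀ u → d u u ≡ 0
  d-self u = n≤0⇒n≡0 (d≤ (0 , z≤n , stop tt))

  d≡0 : ∀ {u v} → d u v ≤ 0 → u ≡ v
  d≡0 le with distLe z≤n le
  ... | zero , _ , stop _ = refl

  -- Bounds beyond `R` hold by truncation, so the metric inequalities need proof only where actual
  -- walks exist.
  capped : ∀ {u v k} → (k ≤ R → DistLe G u v k) → d u v ≤ k
  capped {u} {v} {k} f with k ≤? R
  ... | yes le = d≤ (f le)
  ... | no gt  = ≤-trans (d≤R+1 u v) (≰⇒> gt)

  d-triangle : ∀ u w v → d u v ≤ d u w + d w v
  d-triangle u w v = capped λ le →
    let k , k≤ , p = distLe (≤-trans (m≤m+n _ _) le) ≤-refl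
        ℓ , ℓ≤ , q = distLe (≤-trans (m≤n+m _ (d u w)) le) ≤-refl
    in k + ℓ , +-mono-≤ k≤ ℓ≤ , walk-trans p q

  d-sym≤ : ∀ u v → d u v ≤ d v u
  d-sym≤ u v = capped λ le → let ℓ , ℓ≤ , p = distLe le ≤-refl in ℓ , ℓ≤ , walk-rev p

  d-sym : ∀ u v → d u v ≡ d v u
  d-sym u v = ≤-antisym (d-sym≤ u v) (d-sym≤ v u)

  d-step : ∀ {u w} v → Adj u w → d u v ≤ suc (d w v)
  d-step v uw = capped λ le → distLe-step uw (distLe (≤-trans (n≤1+n _) le) ≤-refl)

  d-descend : ∀ {u v} → ¬ u ≡ v → d u v ≤ R → ∃[ w ] (Adj u w × d w v < d u v)
  d-descend {u} {v} u≢v le with distLe le ≤-refl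
  ... | zero , _ , stop _ = contradiction refl u≢v
  ... | suc ℓ , ℓ< , step _ uw p = _ , uw , ≤-trans (s≤s (d≤ (ℓ , ≤-refl , p))) ℓ<

-- Exclusive pairs and weighted Voronoi cells.

module Exclusivity {q M : ℕ} (In : Fin q → Fin M → Set) (in? : (v : Fin q) (a : Fin M) → Dec (In v a)) where

  -- Here `i` and `j` are positions in a tuple that may repeat elements, as samples drawn with
  -- replacement do; a repetition at a third position spoils the pair.
  Exclusive : ∀ {N} → (Fin N → Fin M) → Fin N → Fin N → Set
  Exclusive p i j = ¬ i ≡ j × ∃[ v ] (In v (p i) × In v (p j) × ∀ l → In v (p l) → l ≡ i ⊎ l ≡ j)

  abstract
    exclusive? : ∀ {N} (p : Fin N → Fin M) i j → Dec (Exclusive p i j)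
    exclusive? p i j = ¬? (i Fin.≟ j) ×-dec Fin.any? λ v →
      in? v (p i) ×-dec (in? v (p j) ×-dec Fin.all? λ l → in? v (p l) →-dec ((l Fin.≟ i) ⊎-dec (l Fin.≟ j)))

  FewExclusivePairs : ℕ → Set
  FewExclusivePairs K = ∀ {N} (p : Fin N → Fin M) → sum₂ (λ i j → 𝟙 (exclusive? p i j)) ≤ K * N

-- Additively weighted Voronoi cells; key breaks the ties of the weighted distance kd by the
-- index of the site.
module Voronoi (G : Graph) (adj? : (u v : Fin (Graph.n G)) → Dec (Graph.Adj G u v))
               (t : ℕ) (minorFree : ¬ HasMinorK G t) (R : ℕ)
               {N : ℕ} (x : Fin N → Fin (Graph.n G)) (h : Fin N → ℕ) where
  open Graph G using (n; Adj)
  open Blobs G adj?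
  open Distance G adj? R

  kd : Fin n → Fin N → ℕ
  kd w i = d w (x i) + h i

  key : Fin n → Fin N → ℕ
  key w i = toℕ i + N * kd w i

  -- The cutoff at `R` discards vertices whose distance to the site might be truncated, so that a
  -- shortest path to the site exists.
  Cell : Fin N → Fin n → Set
  Cell i w = kd w i ≤ R × (∀ k → key w i ≤ key w k)

  cell? : ∀ i w → Dec (Cell i w)
  cell? i w = (kd w i ≤? R) ×-dec Fin.all? λ k → key w i ≤? key w k

  -- Since `toℕ i < N`, comparing keys is lexicographic, with `kd` first.
  key≤⇒kd≤ : ∀ {w i k} → key w k ≤ key w i → kd w k ≤ kd w i
  key≤⇒kd≤ {w} {i} {k} le = ≮⇒≥ λ lt → <-irrefl refl (begin-strict
    N + N * kd w i        ≡⟨ sym (*-suc N _) ⟩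
    N * suc (kd w i)      ≤⟨ *-monoʳ-≤ N lt ⟩
    N * kd w k            ≤⟨ m≤n+m _ (toℕ k) ⟩
    key w k               ≤⟨ le ⟩
    toℕ i + N * kd w i    <⟨ +-monoˡ-< _ (Fin.toℕ<n i) ⟩
    N + N * kd w i        ∎)
    where open ≤-Reasoning

  key-injective : ∀ {w i k} → key w i ≡ key w k → i ≡ k
  key-injective {w} {i} {k} eq = Fin.toℕ-injective (+-cancelʳ-≡ (N * kd w i) _ _
    (trans eq (cong (λ z → toℕ k + N * z) (≤-antisym (key≤⇒kd≤ (≤-reflexive (sym eq))) (key≤⇒kd≤ (≤-reflexive eq))))))

  key-closer : ∀ {w w′ i} → d w′ (x i) < d w (x i) → N + key w′ i ≤ key w i
  key-closer {w} {w′} {i} lt = begin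
    N + (toℕ i + N * kd w′ i)   ≡⟨ rearrange N (toℕ i) (kd w′ i) ⟩
    toℕ i + N * suc (kd w′ i)   ≤⟨ +-monoʳ-≤ (toℕ i) (*-monoʳ-≤ N (+-monoˡ-≤ (h i) lt)) ⟩
    key w i                     ∎
    where
    open ≤-Reasoning
    rearrange : ∀ a b c → a + (b + a * c) ≡ b + a * suc c
    rearrange = solve-∀

  key-step : ∀ {w w′ i} → Adj w w′ → key w i ≤ N + key w′ i
  key-step {w} {w′} {i} ww′ = begin
    key w i                     ≤⟨ +-monoʳ-≤ (toℕ i) (*-monoʳ-≤ N (+-monoˡ-≤ (h i) (d-step (x i) ww′))) ⟩
    toℕ i + N * suc (kd w′ i)   ≡⟨ rearrange N (toℕ i) (kd w′ i) ⟩
    N + key w′ i                ∎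
    where
    open ≤-Reasoning
    rearrange : ∀ a b c → b + a * suc c ≡ a + (b + a * c)
    rearrange = solve-∀

  nearest : ∀ {w i} → kd w i ≤ R → ∃[ k ] Cell k w
  nearest {w} {i} le =
    let k , least = minimiser (key w) i in k , ≤-trans (key≤⇒kd≤ (least i)) le , least

  cell-unique : ∀ {i k w} → Cell i w → Cell k w → i ≡ k
  cell-unique (_ , p) (_ , q) = key-injective (≤-antisym (p _) (q _))

  -- A step towards `x i` lowers the key of `i` by at least `N` and any other key by at most `N`, so
  -- `i` stays the least.
  cell-closer : ∀ {w w′ i} → Adj w w′ → d w′ (x i) < d w (x i) → Cell i w → Cell i w′
  cell-closer {i = i} ww′ lt (le , least) =
    ≤-trans (+-monoˡ-≤ (h i) (<⇒≤ lt)) le ,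
    λ k → +-cancelˡ-≤ N _ _ (≤-trans (key-closer lt) (≤-trans (least k) (key-step ww′)))

  walk-to-centre : ∀ m {w i} → d w (x i) ≤ m → Cell i w → ∃[ ℓ ] WalkIn G (Cell i) w (x i) ℓ
  walk-to-centre zero    {i = i} le c = 0 , subst (λ z → WalkIn G (Cell i) _ z 0) (d≡0 le) (stop c)
  walk-to-centre (suc m) {w} {i} le c@(near , _) with w Fin.≟ x i
  ... | yes refl = 0 , stop c
  ... | no w≢x =
    let w′ , ww′ , lt = d-descend w≢x (≤-trans (m≤m+n _ (h i)) near)
        ℓ , p = walk-to-centre m (≤-pred (≤-trans lt le)) (cell-closer ww′ lt c)
    in suc ℓ , step c ww′ p

  cell : Fin N → Blob
  cell i = filter (cell? i) (allFin n)

  ∈cell⁺ : ∀ {i w} → Cell i w → w ∈ cell i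
  ∈cell⁺ {i} c = ∈-filter⁺ (cell? i) (∈-allFin _) c

  ∈cell⁻ : ∀ {i w} → w ∈ cell i → Cell i w
  ∈cell⁻ {i} w∈ = proj₂ (∈-filter⁻ (cell? i) {xs = allFin n} w∈)

  cell-connected : ∀ i → Connected (cell i)
  cell-connected i u w u∈ w∈ =
    let _ , p = walk-to-centre _ ≤-refl (∈cell⁻ u∈)
        _ , q = walk-to-centre _ ≤-refl (∈cell⁻ w∈)
    in _ , walk-map ∈cell⁺ (walk-trans p (walk-rev q))

  cell-disjoint : ∀ {i j} → ¬ i ≡ j → Disj (cell i) (cell j)
  cell-disjoint ne w p q = ne (cell-unique (∈cell⁻ p) (∈cell⁻ q))

  open SparseCells G adj? t minorFree
  open Links cell cell-connected cell-disjoint public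

  link-sym : ∀ {i j} → Link i j → Link j i
  link-sym (ne , tch) = ne ∘ sym , touch-sym tch

  -- By `walk-to-centre` this is equivalent to the cell of `i` being nonempty.
  Centred : Fin N → Set
  Centred i = Cell i (x i)

  -- Follow a shortest path from v to the site x i: the last cell that it leaves before
  -- entering the cell of i is that of the required k.
  closer-link : ∀ m {v i} → d v (x i) ≤ m → Centred i → kd v i ≤ R → ¬ Cell i v →
    ∃[ k ] (Link i k × key v k < key v i)
  closer-link zero {i = i} le c near ¬cv = contradiction (subst (Cell i) (sym (d≡0 le)) c) ¬cv
  closer-link (suc m) {v} {i} le c near ¬cv with v Fin.≟ x i
  ... | yes refl = contradiction c ¬cv
  ... | no v≢x with d-descend v≢x (≤-trans (m≤m+n _ (h i)) near)
  ...   | w , vw , lt with cell? i w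
  ...     | yes cw =
    let j , cj = nearest {v} {i} near
        i≢j = λ i≡j → ¬cv (subst (λ z → Cell z v) (sym i≡j) cj)
    in j , (i≢j , touch (∈cell⁺ cw) (∈cell⁺ cj) (Graph.sym G vw)) ,
       ≤∧≢⇒< (proj₂ cj i) λ e → i≢j (sym (key-injective e))
  ...     | no ¬cw =
    let j , link , less = closer-link m (≤-pred (≤-trans lt le)) c (≤-trans (+-monoˡ-≤ (h i) (<⇒≤ lt)) near) ¬cw
    in j , link , ≤-<-trans (key-step vw) (<-≤-trans (+-monoʳ-< N less) (key-closer lt))

  -- The cells of `i` and `j` cannot both contain `v`. For one that does not, `closer-link` finds a
  -- linked site within `s` of `v`, which can only be the other member of the pair.
  exclusive⇒link : ∀ {v s i j} → s ≤ R → Centred i → Centred j → ¬ i ≡ j → kd v i ≤ s → kd v j ≤ s →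
    (∀ l → kd v l ≤ s → l ≡ i ⊎ l ≡ j) → Link i j
  exclusive⇒link {v} {s} {i} {j} s≤R ci cj ne vi vj only with cell? i v
  ... | no ¬civ with closer-link _ ≤-refl ci (≤-trans vi s≤R) ¬civ
  ...   | k , link , lt with only k (≤-trans (key≤⇒kd≤ (<⇒≤ lt)) vi)
  ...     | inj₁ refl = contradiction refl (<⇒≢ lt)
  ...     | inj₂ refl = link
  exclusive⇒link {v} {s} {i} {j} s≤R ci cj ne vi vj only | yes civ
    with closer-link _ ≤-refl cj (≤-trans vj s≤R) (λ cjv → ne (cell-unique civ cjv))
  ...   | k , link , lt with only k (≤-trans (key≤⇒kd≤ (<⇒≤ lt)) vj)
  ...     | inj₁ refl = link-sym link
  ...     | inj₂ refl = contradiction refl (<⇒≢ lt)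

  -- The owner `k` of the vertex `x i` beats `i` at the site of `i` itself, where the weighted
  -- distance of `i` is just `h i`.
  uncentred : ∀ {i} → h i ≤ R → ¬ Centred i → ∃[ k ] (¬ k ≡ i × d (x i) (x k) + h k ≤ h i)
  uncentred {i} le ¬c with nearest {x i} {i} (subst (λ z → z + h i ≤ R) (sym (d-self (x i))) le)
  ... | k , ck = k , (λ k≡i → ¬c (subst (λ z → Cell z (x i)) k≡i ck)) ,
    subst (λ z → kd (x i) k ≤ z + h i) (d-self (x i)) (key≤⇒kd≤ (proj₂ ck i))

  -- Charge each site in range of `v` to its link to a closer site, which is again in range; only
  -- the owner of the cell at `v` may lack one.
  covering-links : (∀ i → Centred i) → ∀ v →
    sum (λ i → 𝟙 (kd v i ≤? R)) ≤
      1 + sum₂ (λ i k → 𝟙 (link? i k ×-dec ((kd v i ≤? R) ×-dec (kd v k ≤? R))))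
  covering-links centred v = begin
    sum (λ i → 𝟙 (kd v i ≤? R))                      ≤⟨ sum-mono home-or-link ⟩
    sum (λ i → 𝟙 (cell? i v) + sum (linked i))       ≡⟨ ∑-distrib-+ (λ i → 𝟙 (cell? i v)) (λ i → sum (linked i)) ⟩
    sum (λ i → 𝟙 (cell? i v)) + sum₂ linked          ≤⟨ +-monoˡ-≤ _ (sum-unique≤1 (λ i → cell? i v) cell-unique) ⟩
    1 + sum₂ linked                                  ∎
    where
    open ≤-Reasoning
    linked : Fin N → Fin N → ℕ
    linked i k = 𝟙 (link? i k ×-dec ((kd v i ≤? R) ×-dec (kd v k ≤? R)))
    home-or-link : ∀ i → 𝟙 (kd v i ≤? R) ≤ 𝟙 (cell? i v) + sum (linked i)
    home-or-link i = 𝟙-cover (kd v i ≤? R) λ near → claim near (cell? i v)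
      where
      claim : kd v i ≤ R → (c : Dec (Cell i v)) → 1 ≤ 𝟙 c + sum (linked i)
      claim near (yes _) = s≤s z≤n
      claim near (no ¬c) =
        let k , link , lt = closer-link _ ≤-refl (centred i) near ¬c
        in ≤-trans (≤-reflexive (sym (𝟙-yes (link? i k ×-dec ((kd v i ≤? R) ×-dec (kd v k ≤? R)))
                     (link , near , ≤-trans (key≤⇒kd≤ (<⇒≤ lt)) near))))
             (term≤sum (linked i) k)

-- Covers both pairs of balls sharing a vertex (the sites are the balls, with weight R ∸ radius)
-- and pairs of vertices sharing a ball (the sites are the vertices, with weight 0).
module SiteQueries (G : Graph) (adj? : (u v : Fin (Graph.n G)) → Dec (Graph.Adj G u v))
                   (t : ℕ) (minorFree : ¬ HasMinorK G t) (R : ℕ)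
                   {M q : ℕ} (X : Fin M → Fin (Graph.n G)) (H : Fin M → ℕ)
                   (position : Fin q → Fin (Graph.n G)) (reach : Fin q → ℕ) (reach≤R : (v : Fin q) → reach v ≤ R)
                   (In : Fin q → Fin M → Set) (in? : (v : Fin q) (a : Fin M) → Dec (In v a))
                   (to : (v : Fin q) (a : Fin M) → In v a →
                     Distance.d G adj? R (position v) (X a) + H a ≤ reach v)
                   (from : (v : Fin q) (a : Fin M) →
                     Distance.d G adj? R (position v) (X a) + H a ≤ reach v → In v a)
                   where
  open Distance G adj? R
  open Exclusivity In in?

  -- Positions with distinct elements are linked. Equal elements are counted apart: exclusivity
  -- leaves no room for a third copy, so each position has at most one twin.
  few-exclusive-pairs : (∀ a b → d (X a) (X b) + H b ≤ H a → a ≡ b) → FewExclusivePairs (2 * density t + 1)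
  few-exclusive-pairs undominated {N} p = begin
    sum₂ (λ i j → 𝟙 (exclusive? p i j))
      ≤⟨ sum₂-mono link-or-twin ⟩
    sum₂ (λ i j → links i j + twins i j)
      ≡⟨ sum₂-distrib-+ links twins ⟩
    sum₂ links + sum₂ twins
      ≤⟨ +-mono-≤ (links-sparse {U = λ _ → ⊤} λ _ → yes tt) (sum-mono one-twin) ⟩
    2 * density t * sum {N} (λ _ → 1) + sum {N} (λ _ → 1)
      ≡⟨ cong (λ z → 2 * density t * z + z) (trans (sum-const N 1) (*-identityʳ N)) ⟩
    2 * density t * N + N
      ≡⟨ collect (density t) N ⟩
    (2 * density t + 1) * N ∎
    where
    open ≤-Reasoning
    open Voronoi G adj? t minorFree R (X ∘ p) (H ∘ p)
    collect : ∀ c N → 2 * c * N + N ≡ (2 * c + 1) * N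
    collect = solve-∀
    twin? : ∀ i j → Dec (Exclusive p i j × p i ≡ p j)
    twin? i j = exclusive? p i j ×-dec (p i Fin.≟ p j)
    links twins : Fin N → Fin N → ℕ
    links i j = 𝟙 (link? i j ×-dec (yes tt ×-dec yes tt))
    twins i j = 𝟙 (twin? i j)
    -- An uncentred site would have its own element at another position `k`. That copy contains `v`
    -- too, so `k` is `j`, against `p i` and `p j` being distinct.
    centred : ∀ {i j v} → ¬ p i ≡ p j → In v (p i) → (∀ l → In v (p l) → l ≡ i ⊎ l ≡ j) → Centred i
    centred {i} {j} {v} ne vi only = decidable-stable (cell? i (X (p i))) λ ¬c →
      let k , k≢i , dom = uncentred (≤-trans (m≤n+m _ _) (≤-trans (to v (p i) vi) (reach≤R v))) ¬c
          same = undominated (p i) (p k) dom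
      in either k≢i (λ k≡j → ne (trans same (cong p k≡j))) (only k (subst (In v) same vi))
    exclusive⇒ : ∀ {i j} → Exclusive p i j → ¬ p i ≡ p j → Link i j
    exclusive⇒ (i≢j , v , vi , vj , only) ne =
      exclusive⇒link (reach≤R v) (centred ne vi only)
        (centred (ne ∘ sym) vj λ l vl → either inj₂ inj₁ (only l vl)) i≢j
        (to v _ vi) (to v _ vj) λ l near → only l (from v (p l) near)
    link-or-twin : ∀ i j → 𝟙 (exclusive? p i j) ≤ links i j + twins i j
    link-or-twin i j = 𝟙-cover (exclusive? p i j) λ e → claim e (p i Fin.≟ p j)
      where
      claim : Exclusive p i j → Dec (p i ≡ p j) → 1 ≤ links i j + twins i j
      claim e (yes eq) = ≤-trans (≤-reflexive (sym (𝟙-yes (twin? i j) (e , eq)))) (m≤n+m _ _)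
      claim e (no ne)  = ≤-trans (≤-reflexive (sym (𝟙-yes (link? i j ×-dec (yes tt ×-dec yes tt))
                                                       (exclusive⇒ e ne , tt , tt)))) (m≤m+n _ _)
    one-twin : ∀ i → sum (twins i) ≤ 1
    one-twin i = sum-unique≤1 (twin? i) λ { ((_ , v , vi , _ , only) , _) ((i≢k , _) , eq) →
      either (λ k≡i → contradiction (sym k≡i) i≢k) sym (only _ (subst (In v) eq vi)) }

-- Random sampling.

-- The sample space is finite, so a counting argument for existence can be turned into a search.
vec-search : ∀ {M} N {P : Vec (Fin M) N → Set} → (∀ p → Dec (P p)) → Dec (∃ P)
vec-search zero    p? = map′ (λ x → [] , x) (λ { ([] , x) → x }) (p? [])
vec-search (suc N) p? = map′ (λ (a , p , x) → a ∷ p , x) (λ { (a ∷ p , x) → a , p , x })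
  (Fin.any? λ a → vec-search N λ p → p? (a ∷ p))

-- E N f is T ^ N times the expectation of f over N independent samples with weights w.
module Sampling {M : ℕ} (w : Fin M → ℕ) where

  T : ℕ
  T = sum w

  abstract
    E : ∀ N → (Vec (Fin M) N → ℕ) → ℕ
    E zero    f = f []
    E (suc N) f = sum λ a → w a * E N (λ p → f (a ∷ p))

    E-mono : ∀ N {f g} → (∀ p → f p ≤ g p) → E N f ≤ E N g
    E-mono zero    h = h []
    E-mono (suc N) h = sum-mono λ a → *-monoʳ-≤ (w a) (E-mono N λ p → h (a ∷ p))

    E-cong : ∀ N {f g} → (∀ p → f p ≡ g p) → E N f ≡ E N g
    E-cong N h = ≤-antisym (E-mono N λ p → ≤-reflexive (h p)) (E-mono N λ p → ≤-reflexive (sym (h p)))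

    E-const : ∀ N c → E N (λ _ → c) ≡ T ^ N * c
    E-const zero    c = sym (+-identityʳ c)
    E-const (suc N) c = begin
      sum (λ a → w a * E N (λ _ → c))   ≡⟨ sum-cong-≗ (λ a → cong (w a *_) (E-const N c)) ⟩
      sum (λ a → w a * (T ^ N * c))     ≡⟨ sym (*-distribʳ-sum (T ^ N * c) w) ⟩
      T * (T ^ N * c)                   ≡⟨ sym (*-assoc T _ c) ⟩
      T * T ^ N * c                     ∎
      where open ≡-Reasoning

    E-+ : ∀ N f g → E N (λ p → f p + g p) ≡ E N f + E N g
    E-+ zero    f g = refl
    E-+ (suc N) f g = trans
      (sum-cong-≗ λ a → trans (cong (w a *_) (E-+ N _ _)) (*-distribˡ-+ (w a) (E N λ p → f (a ∷ p)) _))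
      (∑-distrib-+ (λ a → w a * E N (λ p → f (a ∷ p))) _)

    E-sum : ∀ N {k} (f : Fin k → Vec (Fin M) N → ℕ) → E N (λ p → sum λ i → f i p) ≡ sum λ i → E N (f i)
    E-sum N {zero}  f = trans (E-const N 0) (*-zeroʳ (T ^ N))
    E-sum N {suc k} f = trans (E-+ N (f zero) _) (cong (E N (f zero) +_) (E-sum N (f ∘ suc)))

    E-* : ∀ N c f → E N (λ p → c * f p) ≡ c * E N f
    E-* zero    c f = refl
    E-* (suc N) c f = trans
      (sum-cong-≗ λ a → trans (cong (w a *_) (E-* N c λ p → f (a ∷ p))) (swap (w a) c _))
      (sym (*-distribˡ-sum c λ a → w a * E N (λ p → f (a ∷ p))))
      where
      swap : ∀ x y z → x * (y * z) ≡ y * (x * z)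
      swap = solve-∀

    -- Replacing one coordinate by a fresh independent sample does not change the distribution; the
    -- factor `T` normalises the additional draw.
    resample : ∀ N (i : Fin N) f → T * E N f ≡ E N (λ p → sum λ a → w a * f (p [ i ]≔ a))
    resample (suc N) zero f = sym (begin
      sum (λ b → w b * E N (λ p → sum λ a → w a * f (a ∷ p)))
        ≡⟨ sym (*-distribʳ-sum (E N (λ p → sum λ a → w a * f (a ∷ p))) w) ⟩
      T * E N (λ p → sum λ a → w a * f (a ∷ p))
        ≡⟨ cong (T *_) (trans (E-sum N λ a p → w a * f (a ∷ p)) (sum-cong-≗ λ a → E-* N (w a) λ p → f (a ∷ p))) ⟩
      T * E (suc N) f ∎)
      where open ≡-Reasoning
    resample (suc N) (suc i) f = begin
      T * E (suc N) f
        ≡⟨ *-distribˡ-sum T (λ a → w a * E N (λ p → f (a ∷ p))) ⟩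
      sum (λ b → T * (w b * E N (λ p → f (b ∷ p))))
        ≡⟨ sum-cong-≗ (λ b → trans (swap T (w b) _) (cong (w b *_) (resample N i λ p → f (b ∷ p)))) ⟩
      E (suc N) (λ p → sum λ a → w a * f (p [ suc i ]≔ a)) ∎
      where
      open ≡-Reasoning
      swap : ∀ x y z → x * (y * z) ≡ y * (x * z)
      swap = solve-∀

  resample₂ : ∀ N (i j : Fin N) f →
    T * (T * E N f) ≡ E N (λ p → sum₂ λ b a → w b * (w a * f ((p [ j ]≔ b) [ i ]≔ a)))
  resample₂ N i j f = begin
    T * (T * E N f)
      ≡⟨ cong (T *_) (resample N i f) ⟩
    T * E N (λ p → sum λ a → w a * f (p [ i ]≔ a))
      ≡⟨ resample N j _ ⟩
    E N (λ p → sum λ b → w b * sum λ a → w a * f ((p [ j ]≔ b) [ i ]≔ a))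
      ≡⟨ E-cong N (λ p → sum-cong-≗ λ b → *-distribˡ-sum (w b) λ a → w a * f ((p [ j ]≔ b) [ i ]≔ a)) ⟩
    E N (λ p → sum₂ λ b a → w b * (w a * f ((p [ j ]≔ b) [ i ]≔ a))) ∎
    where open ≡-Reasoning

  lookup-pair : ∀ {N} (p : Vec (Fin M) N) {i j} b a → ¬ i ≡ j →
    lookup ((p [ j ]≔ b) [ i ]≔ a) i ≡ a × lookup ((p [ j ]≔ b) [ i ]≔ a) j ≡ b
  lookup-pair p {i} {j} b a i≢j =
    lookup∘update i (p [ j ]≔ b) a ,
    trans (lookup∘update′ (i≢j ∘ sym) (p [ j ]≔ b) a) (lookup∘update j p b)

  module _ {q : ℕ} (In : Fin q → Fin M → Set) (in? : (v : Fin q) (a : Fin M) → Dec (In v a)) (K : ℕ)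
           (few : Exclusivity.FewExclusivePairs In in? K) (T>0 : 1 ≤ T) where
    open Exclusivity In in?
    open ≤-Reasoning

    mass : Fin q → ℕ
    mass v = sum λ a → w a * 𝟙 (in? v a)

    mass-square : ∀ v → sum₂ (λ b a → w b * (w a * (𝟙 (in? v a) * 𝟙 (in? v b)))) ≡ mass v * mass v
    mass-square v = trans
      (sum-cong-≗ λ b → trans
        (sum-cong-≗ λ a → rearrange (w b) (w a) (𝟙 (in? v a)) (𝟙 (in? v b)))
        (sym (*-distribˡ-sum (w b * 𝟙 (in? v b)) λ a → w a * 𝟙 (in? v a))))
      (sym (*-distribʳ-sum (mass v) λ b → w b * 𝟙 (in? v b)))
      where
      rearrange : ∀ b a x y → b * (a * (x * y)) ≡ b * y * (a * x)
      rearrange = solve-∀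

    exclusive : ∀ {N} → Fin N → Fin N → Vec (Fin M) N → ℕ
    exclusive i j p = 𝟙 (exclusive? (lookup p) i j)

    T-cancel : ∀ {x y} → T * x ≤ T * y → x ≤ y
    T-cancel = *-cancelˡ-≤ T {{>-nonZero T>0}}

    T^>0 : ∀ N → 1 ≤ T ^ N
    T^>0 N = m^n>0 T {{>-nonZero T>0}} N

    -- Double counting of exclusive pairs: N(N-1) ordered pairs contribute at least `A` each, while
    -- every sample has at most `K * N` of them. The summand `A` on the right replaces a subtraction
    -- on the left.
    pairs-bound : ∀ N A c → (∀ (i j : Fin (suc N)) → ¬ i ≡ j → A ≤ c * E (suc N) (exclusive i j)) →
      suc N * A ≤ A + c * (T ^ suc N * K)
    pairs-bound N′ A c lower = *-cancelˡ-≤ N (begin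
      N * (N * A)                                            ≡⟨ sym (sum-const N (N * A)) ⟩
      sum {N} (λ _ → N * A)                                  ≤⟨ sum-mono row ⟩
      sum (λ i → A + sum (λ j → c * E N (exclusive i j)))    ≡⟨ ∑-distrib-+ {N} (λ _ → A) (λ i → sum (λ j → c * E N (exclusive i j))) ⟩
      sum {N} (λ _ → A) + sum₂ (λ i j → c * E N (exclusive i j))
        ≡⟨ cong₂ _+_ (sum-const N A) (sym (*-distribˡ-sum₂ c λ i j → E N (exclusive i j))) ⟩
      N * A + c * sum₂ (λ i j → E N (exclusive i j))
        ≡⟨ cong (λ z → N * A + c * z) (sym (trans (E-sum N λ i p → sum λ j → exclusive i j p)
             (sum-cong-≗ λ i → E-sum N (exclusive i)))) ⟩
      N * A + c * E N (λ p → sum₂ λ i j → exclusive i j p)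
        ≤⟨ +-monoʳ-≤ (N * A) (*-monoʳ-≤ c (E-mono N λ p → few (lookup p))) ⟩
      N * A + c * E N (λ _ → K * N)
        ≡⟨ cong (λ z → N * A + c * z) (E-const N (K * N)) ⟩
      N * A + c * (T ^ N * (K * N))
        ≡⟨ factor N A c (T ^ N) K ⟩
      N * (A + c * (T ^ N * K)) ∎)
      where
      N = suc N′
      factor : ∀ N A c P K → N * A + c * (P * (K * N)) ≡ N * (A + c * (P * K))
      factor = solve-∀
      row : ∀ i → N * A ≤ A + sum (λ j → c * E N (exclusive i j))
      row i = begin
        N * A                                         ≤⟨ *-monoˡ-≤ A (sum-≢ i) ⟩
        A + sum (λ j → 𝟙 (¬? (i Fin.≟ j))) * A        ≡⟨ cong (A +_) (*-distribʳ-sum A λ j → 𝟙 (¬? (i Fin.≟ j))) ⟩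
        A + sum (λ j → 𝟙 (¬? (i Fin.≟ j)) * A)        ≤⟨ +-monoʳ-≤ A (sum-mono entry) ⟩
        A + sum (λ j → c * E N (exclusive i j))       ∎
        where
        entry : ∀ j → 𝟙 (¬? (i Fin.≟ j)) * A ≤ c * E N (exclusive i j)
        entry j with i Fin.≟ j
        ... | yes _  = z≤n
        ... | no i≢j = ≤-trans (≤-reflexive (+-identityʳ A)) (lower i j i≢j)

    module _ (ρ : ℕ) where

      Missed : ∀ {N} → Vec (Fin M) N → Set
      Missed p = ∃[ v ] (T < ρ * mass v × ∀ i → ¬ In v (lookup p i))

      missed? : ∀ {N} (p : Vec (Fin M) N) → Dec (Missed p)
      missed? p = Fin.any? λ v → (T <? ρ * mass v) ×-dec Fin.all? λ i → ¬? (in? v (lookup p i))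

      -- If every sample is missed by a heavy set v, then resampling two of its members inside v
      -- makes them an exclusive pair, so that exclusive pairs are too frequent.
      not-all-missed : ¬ (∀ (p : Vec (Fin M) (2 + K * (ρ * ρ))) → Missed p)
      -- The pair count forces N - 1 to be at most `K * (ρ * ρ)`, which this sample size exceeds by
      -- one.
      not-all-missed missed = <-irrefl refl (*-cancelʳ-≤ (2 + K * (ρ * ρ)) (1 + K * (ρ * ρ)) (T ^ N) {{>-nonZero (T^>0 N)}} (begin
        N * T ^ N                        ≤⟨ pairs-bound (1 + K * (ρ * ρ)) (T ^ N) (ρ * ρ) frequent ⟩
        T ^ N + ρ * ρ * (T ^ N * K)      ≡⟨ factor (T ^ N) ρ K ⟩
        (1 + K * (ρ * ρ)) * T ^ N        ∎))
        where
        N = 2 + K * (ρ * ρ)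
        factor : ∀ P ρ K → P + ρ * ρ * (P * K) ≡ (1 + K * (ρ * ρ)) * P
        factor = solve-∀
        frequent : ∀ i j → ¬ i ≡ j → T ^ N ≤ ρ * ρ * E N (exclusive i j)
        frequent i j i≢j = T-cancel (T-cancel (begin
          T * (T * T ^ N)
            ≡⟨ cong (λ z → T * (T * z)) (sym (trans (E-const N 1) (*-identityʳ (T ^ N)))) ⟩
          T * (T * E N (λ _ → 1))
            ≡⟨ trans (sym (*-assoc T T _)) (sym (E-* N (T * T) λ _ → 1)) ⟩
          E N (λ _ → T * T * 1)
            ≤⟨ E-mono N pointwise ⟩
          E N (λ p → ρ * ρ * sum₂ λ b a → w b * (w a * exclusive i j ((p [ j ]≔ b) [ i ]≔ a)))
            ≡⟨ E-* N (ρ * ρ) _ ⟩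
          ρ * ρ * E N (λ p → sum₂ λ b a → w b * (w a * exclusive i j ((p [ j ]≔ b) [ i ]≔ a)))
            ≡⟨ cong (ρ * ρ *_) (sym (resample₂ N i j (exclusive i j))) ⟩
          ρ * ρ * (T * (T * E N (exclusive i j)))
            ≡⟨ pull ρ T (E N (exclusive i j)) ⟩
          T * (T * (ρ * ρ * E N (exclusive i j))) ∎))
          where
          pull : ∀ r t e → r * r * (t * (t * e)) ≡ t * (t * (r * r * e))
          pull = solve-∀
          pointwise : ∀ p → T * T * 1 ≤ ρ * ρ * sum₂ λ b a → w b * (w a * exclusive i j ((p [ j ]≔ b) [ i ]≔ a))
          pointwise p with missed p
          ... | v , heavy , none = begin
            T * T * 1                          ≡⟨ *-identityʳ (T * T) ⟩
            T * T                              ≤⟨ *-mono-≤ (<⇒≤ heavy) (<⇒≤ heavy) ⟩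
            ρ * mass v * (ρ * mass v)          ≡⟨ square ρ (mass v) ⟩
            ρ * ρ * (mass v * mass v)          ≡⟨ cong (ρ * ρ *_) (sym (mass-square v)) ⟩
            ρ * ρ * sum₂ (λ b a → w b * (w a * (𝟙 (in? v a) * 𝟙 (in? v b))))
              ≤⟨ *-monoʳ-≤ (ρ * ρ) (sum₂-mono λ b a → *-monoʳ-≤ (w b) (*-monoʳ-≤ (w a) (pair b a))) ⟩
            ρ * ρ * sum₂ (λ b a → w b * (w a * exclusive i j ((p [ j ]≔ b) [ i ]≔ a))) ∎
            where
            square : ∀ r m → r * m * (r * m) ≡ r * r * (m * m)
            square = solve-∀
            pair : ∀ b a → 𝟙 (in? v a) * 𝟙 (in? v b) ≤ exclusive i j ((p [ j ]≔ b) [ i ]≔ a)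
            pair b a = ≤-trans (≤-reflexive (sym (𝟙-× (in? v a) (in? v b))))
              (𝟙-mono (in? v a ×-dec in? v b) (exclusive? (lookup p′) i j) λ (va , vb) →
                i≢j , v , subst (In v) (sym at-i) va , subst (In v) (sym at-j) vb , only)
              where
              p′ = (p [ j ]≔ b) [ i ]≔ a
              at-i = proj₁ (lookup-pair p b a i≢j)
              at-j = proj₂ (lookup-pair p b a i≢j)
              only : ∀ l → In v (lookup p′ l) → l ≡ i ⊎ l ≡ j
              only l vl with l Fin.≟ i | l Fin.≟ j
              ... | yes e | _     = inj₁ e
              ... | no _  | yes e = inj₂ e
              ... | no l≢i | no l≢j = ⊥-elim (none l (subst (In v)
                (trans (lookup∘update′ l≢i (p [ j ]≔ b) a) (lookup∘update′ l≢j p b)) vl))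

      -- The size is quadratic in `ρ` but independent of the numbers of sets and elements, which
      -- suffices because `ρ` will depend only on `t`.
      net : ∃[ p ] ∀ v → T < ρ * mass v → ∃[ i ] In v (lookup {n = 2 + K * (ρ * ρ)} p i)
      net with vec-search (2 + K * (ρ * ρ)) (λ p → ¬? (missed? p))
      ... | yes (p , hits) = p , λ v heavy → decidable-stable (Fin.any? λ i → in? v (lookup p i))
                               λ none → hits (v , heavy , λ i vi → none (i , vi))
      ... | no all = ⊥-elim (not-all-missed λ p → decidable-stable (missed? p) λ hits → all (p , hits))

    Meet : Fin M → Fin M → Set
    Meet a b = ∃[ v ] (In v a × In v b)

    meet? : ∀ a b → Dec (Meet a b)
    meet? a b = Fin.any? λ v → in? v a ×-dec in? v b

    meeting : ℕ
    meeting = sum₂ λ a b → w a * (w b * 𝟙 (meet? a b))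

    -- Whether c contains the chosen common element of a and b.
    hit : Fin M → Fin M → Fin M → ℕ
    hit a b c with meet? a b
    ... | yes (v , _) = 𝟙 (in? v c)
    ... | no _        = 0

    hit-witness : ∀ {a b} → Meet a b → ∃[ v ] (In v a × In v b × ∀ c → In v c → 1 ≤ hit a b c)
    hit-witness {a} {b} m with meet? a b
    ... | yes (v , va , vb) = v , va , vb , λ c vc → ≤-reflexive (sym (𝟙-yes (in? v c) vc))
    ... | no ¬m = contradiction m ¬m

    module _ (L N′ : ℕ) (load : ∀ v → mass v ≤ L) (large : 2 * (suc N′ * L) ≤ T) where

      N : ℕ
      N = suc N′

      -- The chosen common element has mass at most `L`, so a fresh sample contains it with
      -- probability at most L/T. Pairs that do not meet give zero on both sides.
      hit-load : ∀ a b → sum (λ c → w c * hit a b c) ≤ L * 𝟙 (meet? a b)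
      hit-load a b with meet? a b
      ... | yes (v , _) = ≤-trans (load v) (≤-reflexive (sym (*-identityʳ L)))
      ... | no _        = ≤-trans (≤-reflexive (trans (sum-cong-≗ λ c → *-zeroʳ (w c)) (trans (sum-const M 0) (*-zeroʳ M)))) z≤n

      module _ (i j : Fin N) (i≢j : ¬ i ≡ j) where

        other? : ∀ l → Dec (¬ l ≡ i × ¬ l ≡ j)
        other? l = ¬? (l Fin.≟ i) ×-dec ¬? (l Fin.≟ j)

        meets : Vec (Fin M) N → ℕ
        meets p = 𝟙 (meet? (lookup p i) (lookup p j))

        spoiled : Fin N → Vec (Fin M) N → ℕ
        spoiled l p = 𝟙 (other? l) * hit (lookup p i) (lookup p j) (lookup p l)

        meets≤ : ∀ p → meets p ≤ exclusive i j p + sum (λ l → spoiled l p)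
        meets≤ p = 𝟙-cover (meet? (lookup p i) (lookup p j)) λ m → claim (hit-witness m)
          where
          claim : ∃[ v ] (In v (lookup p i) × In v (lookup p j) × ∀ c → In v c → 1 ≤ hit (lookup p i) (lookup p j) c) →
            1 ≤ exclusive i j p + sum (λ l → spoiled l p)
          claim (v , vi , vj , hits) with Fin.any? (λ l → other? l ×-dec in? v (lookup p l))
          ... | yes (l , oth , vl) =
            ≤-trans (*-mono-≤ (≤-reflexive (sym (𝟙-yes (other? l) oth))) (hits (lookup p l) vl))
              (≤-trans (term≤sum (λ l → spoiled l p) l) (m≤n+m _ (exclusive i j p)))
          ... | no none = ≤-trans (≤-reflexive (sym (𝟙-yes (exclusive? (lookup p) i j) (i≢j , v , vi , vj , only)))) (m≤m+n _ _)
            where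
            only : ∀ l → In v (lookup p l) → l ≡ i ⊎ l ≡ j
            only l vl with l Fin.≟ i | l Fin.≟ j
            ... | yes e | _     = inj₁ e
            ... | no _  | yes e = inj₂ e
            ... | no l≢i | no l≢j = ⊥-elim (none (l , (l≢i , l≢j) , vl))

        spoiled≤ : ∀ l → T * E N (spoiled l) ≤ L * E N meets
        spoiled≤ l = begin
          T * E N (spoiled l)                                        ≡⟨ resample N l (spoiled l) ⟩
          E N (λ p → sum λ c → w c * spoiled l (p [ l ]≔ c))         ≤⟨ E-mono N pointwise ⟩
          E N (λ p → L * meets p)                                    ≡⟨ E-* N L meets ⟩
          L * E N meets                                              ∎
          where
          pointwise : ∀ p → sum (λ c → w c * spoiled l (p [ l ]≔ c)) ≤ L * meets p
          pointwise p with l Fin.≟ i | l Fin.≟ j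
          ... | yes _ | _     = ≤-trans (≤-reflexive (trans (sum-cong-≗ λ c → *-zeroʳ (w c)) (trans (sum-const M 0) (*-zeroʳ M)))) z≤n
          ... | no _  | yes _ = ≤-trans (≤-reflexive (trans (sum-cong-≗ λ c → *-zeroʳ (w c)) (trans (sum-const M 0) (*-zeroʳ M)))) z≤n
          ... | no l≢i | no l≢j = ≤-trans (≤-reflexive (sum-cong-≗ λ c → cong (w c *_) (trans (+-identityʳ _)
                  (trans (cong₂ (λ a b → hit a b (lookup (p [ l ]≔ c) l)) (lookup∘update′ (l≢i ∘ sym) p c) (lookup∘update′ (l≢j ∘ sym) p c))
                         (cong (hit (lookup p i) (lookup p j)) (lookup∘update l p c))))))
                (hit-load (lookup p i) (lookup p j))

        -- A union bound: given that two samples meet, some other sample spoils the chosen common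
        -- element with probability at most NL/T, which `large` makes at most 1/2.
        meets≤exclusive : E N meets ≤ 2 * E N (exclusive i j)
        meets≤exclusive = T-cancel (+-cancelʳ-≤ (T * m) _ _ (begin
          T * m + T * m                       ≡⟨ double T m ⟩
          2 * (T * m)                         ≤⟨ *-monoʳ-≤ 2 (*-monoʳ-≤ T (E-mono N meets≤)) ⟩
          2 * (T * E N (λ p → exclusive i j p + sum (λ l → spoiled l p)))
            ≡⟨ cong (λ z → 2 * (T * z)) (trans (E-+ N (exclusive i j) _) (cong (e +_) (E-sum N spoiled))) ⟩
          2 * (T * (e + sum (λ l → E N (spoiled l))))
            ≡⟨ spread T e _ ⟩
          T * (2 * e) + 2 * (T * sum (λ l → E N (spoiled l)))
            ≡⟨ cong (λ z → T * (2 * e) + 2 * z) (*-distribˡ-sum T λ l → E N (spoiled l)) ⟩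
          T * (2 * e) + 2 * sum (λ l → T * E N (spoiled l))
            ≤⟨ +-monoʳ-≤ (T * (2 * e)) (*-monoʳ-≤ 2 (sum-mono spoiled≤)) ⟩
          T * (2 * e) + 2 * sum {N} (λ _ → L * m)
            ≡⟨ cong (λ z → T * (2 * e) + 2 * z) (sum-const N (L * m)) ⟩
          T * (2 * e) + 2 * (N * (L * m))
            ≡⟨ cong (T * (2 * e) +_) (regroup N L m) ⟩
          T * (2 * e) + 2 * (N * L) * m
            ≤⟨ +-monoʳ-≤ (T * (2 * e)) (*-monoˡ-≤ m large) ⟩
          T * (2 * e) + T * m ∎))
          where
          m = E N meets
          e = E N (exclusive i j)
          double : ∀ t m → t * m + t * m ≡ 2 * (t * m)
          double = solve-∀
          spread : ∀ t e s → 2 * (t * (e + s)) ≡ t * (2 * e) + 2 * (t * s)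
          spread = solve-∀
          regroup : ∀ n l m → 2 * (n * (l * m)) ≡ 2 * (n * l) * m
          regroup = solve-∀

        meeting-rate : T ^ N * meeting ≡ T * (T * E N meets)
        meeting-rate = sym (begin-equality
          T * (T * E N meets)
            ≡⟨ resample₂ N j i meets ⟩
          E N (λ p → sum₂ λ b a → w b * (w a * meets ((p [ i ]≔ b) [ j ]≔ a)))
            ≡⟨ E-cong N (λ p → sum-cong-≗ λ b → sum-cong-≗ λ a → cong (λ z → w b * (w a * z))
                 (cong₂ (λ x y → 𝟙 (meet? x y)) (proj₂ (lookup-pair p b a (i≢j ∘ sym))) (proj₁ (lookup-pair p b a (i≢j ∘ sym))))) ⟩
          E N (λ _ → meeting)
            ≡⟨ E-const N meeting ⟩
          T ^ N * meeting ∎)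

      -- Two random elements meet with probability at most 2K/(N-1), since half of the meetings
      -- inside a sample are exclusive.
      meeting-bound : N * meeting ≤ meeting + 2 * K * (T * T)
      meeting-bound = *-cancelˡ-≤ (T ^ N) {{>-nonZero (T^>0 N)}} (begin
        T ^ N * (N * meeting)                           ≡⟨ swap (T ^ N) N meeting ⟩
        N * (T ^ N * meeting)                           ≤⟨ pairs-bound N′ (T ^ N * meeting) (2 * (T * T)) frequent ⟩
        T ^ N * meeting + 2 * (T * T) * (T ^ N * K)     ≡⟨ factor (T ^ N) meeting T K ⟩
        T ^ N * (meeting + 2 * K * (T * T))             ∎)
        where
        swap : ∀ x y z → x * (y * z) ≡ y * (x * z)
        swap = solve-∀
        factor : ∀ p m t k → p * m + 2 * (t * t) * (p * k) ≡ p * (m + 2 * k * (t * t))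
        factor = solve-∀
        frequent : ∀ i j → ¬ i ≡ j → T ^ N * meeting ≤ 2 * (T * T) * E N (exclusive i j)
        frequent i j i≢j = begin
          T ^ N * meeting                          ≡⟨ meeting-rate i j i≢j ⟩
          T * (T * E N (meets i j i≢j))            ≤⟨ *-monoʳ-≤ T (*-monoʳ-≤ T (meets≤exclusive i j i≢j)) ⟩
          T * (T * (2 * E N (exclusive i j)))      ≡⟨ regroup T (E N (exclusive i j)) ⟩
          2 * (T * T) * E N (exclusive i j)        ∎
          where
          regroup : ∀ t e → t * (t * (2 * e)) ≡ 2 * (t * t) * e
          regroup = solve-∀

-- Greedy independent sets and a weighted Turán bound.

sum-Σˡ : ∀ {M} {B : Set} (f : Fin M → B → ℕ) (S : List B) →
  sum (λ a → Σˡ (f a) S) ≡ Σˡ (λ s → sum λ a → f a s) S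
sum-Σˡ {M} f []      = trans (sum-const M 0) (*-zeroʳ M)
sum-Σˡ {M} f (s ∷ S) = trans (∑-distrib-+ (λ a → f a s) λ a → Σˡ (f a) S) (cong (sum (λ a → f a s) +_) (sum-Σˡ f S))

Σˡ-All : {B : Set} {f : B → ℕ} {c : ℕ} {S : List B} → All (λ s → f s ≤ c) S → Σˡ f S ≤ length S * c
Σˡ-All []       = z≤n
Σˡ-All (h ∷ hs) = +-mono-≤ h (Σˡ-All hs)

Σˡ-∈ : {B : Set} (f : B → ℕ) {s : B} {S : List B} → s ∈ S → f s ≤ Σˡ f S
Σˡ-∈ f (here refl)       = m≤m+n _ _
Σˡ-∈ f {S = x ∷ _} (there s∈) = ≤-trans (Σˡ-∈ f s∈) (m≤n+m _ (f x))

*-distribʳ-Σˡ : {B : Set} (f : B → ℕ) (c : ℕ) (S : List B) → Σˡ f S * c ≡ Σˡ (λ s → f s * c) S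
*-distribʳ-Σˡ f c []      = refl
*-distribʳ-Σˡ f c (s ∷ S) = trans (*-distribʳ-+ c (f s) (Σˡ f S)) (cong (f s * c +_) (*-distribʳ-Σˡ f c S))

-- The greedy choice runs from the end of the list, so an element is blocked only by one chosen
-- after it; the relation may be asymmetric. The two polymorphic clauses record that `S` inherits
-- the order and properties of `l`.
maximal-independent : ∀ {B : Set} {_~_ : B → B → Set} → (∀ a b → Dec (a ~ b)) → (∀ a → a ~ a) →
  (l : List B) → ∃[ S ] (AllPairs (λ a b → ¬ b ~ a) S × (∀ {Q : B → Set} → All Q l → All Q S) ×
                         (∀ {R : B → B → Set} → AllPairs R l → AllPairs R S) ×
                         (∀ {a} → a ∈ l → ∃[ s ] (s ∈ S × s ~ a)))
maximal-independent _~?_ ~-refl []      = [] , [] , (λ _ → []) , (λ _ → []) , λ ()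
maximal-independent {_~_ = _~_} _~?_ ~-refl (a ∷ l)
  with maximal-independent {_~_ = _~_} _~?_ ~-refl l
... | S , ind , sub , sub₂ , dom with Any.any? (_~? a) S
...   | yes met = S , ind , (λ { (_ ∷ qs) → sub qs }) , (λ { (_ ∷ rs) → sub₂ rs }) ,
  λ { (here refl) → find met ; (there x∈) → dom x∈ }
...   | no ¬met = a ∷ S , All.¬Any⇒All¬ S ¬met ∷ ind , (λ { (q ∷ qs) → q ∷ sub qs }) , (λ { (r ∷ rs) → sub r ∷ sub₂ rs }) ,
  λ { (here refl) → a , here refl , ~-refl a ; (there x∈) → let s , s∈ , s~x = dom x∈ in s , there s∈ , s~x }

module WeightedTurán {M : ℕ} (w : Fin M → ℕ) (_~_ : Fin M → Fin M → Set)
                     (_~?_ : (a b : Fin M) → Dec (a ~ b)) (~-refl : (a : Fin M) → a ~ a) where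
  open ≤-Reasoning

  T : ℕ
  T = sum w

  degree : Fin M → ℕ
  degree a = sum λ b → w b * 𝟙 (a ~? b)

  I : ℕ
  I = sum λ a → w a * degree a

  -- At most twice the average degree I/T, with the division cleared.
  Low : Fin M → Set
  Low a = degree a * T ≤ 2 * I

  low? : ∀ a → Dec (Low a)
  low? a = _ ≤? _

  -- Markov's inequality for the degree of a random element.
  half-low : 1 ≤ I → T ≤ 2 * sum (λ a → w a * 𝟙 (low? a))
  half-low I>0 = +-cancelʳ-≤ T _ _ (begin
    T + T                        ≡⟨ cong₂ _+_ split split ⟩
    (low + high) + (low + high)  ≡⟨ regroup low high ⟩
    2 * low + 2 * high           ≤⟨ +-monoʳ-≤ (2 * low) few-high ⟩
    2 * low + T                  ∎)
    where
    low high : ℕ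
    low  = sum λ a → w a * 𝟙 (low? a)
    high = sum λ a → w a * 𝟙 (¬? (low? a))
    regroup : ∀ l h → (l + h) + (l + h) ≡ 2 * l + 2 * h
    regroup = solve-∀
    split : T ≡ low + high
    split = trans (sum-cong-≗ pointwise) (∑-distrib-+ (λ a → w a * 𝟙 (low? a)) λ a → w a * 𝟙 (¬? (low? a)))
      where
      pointwise : ∀ a → w a ≡ w a * 𝟙 (low? a) + w a * 𝟙 (¬? (low? a))
      pointwise a with low? a
      ... | yes _ = sym (trans (cong₂ _+_ (*-identityʳ (w a)) (*-zeroʳ (w a))) (+-identityʳ _))
      ... | no _  = sym (cong₂ _+_ (*-zeroʳ (w a)) (*-identityʳ (w a)))
    few-high : 2 * high ≤ T
    few-high = *-cancelˡ-≤ I {{>-nonZero I>0}} (begin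
      I * (2 * high)                                      ≡⟨ swap I high ⟩
      high * (2 * I)                                      ≡⟨ *-distribʳ-sum (2 * I) (λ a → w a * 𝟙 (¬? (low? a))) ⟩
      sum (λ a → w a * 𝟙 (¬? (low? a)) * (2 * I))         ≤⟨ sum-mono pointwise ⟩
      sum (λ a → w a * degree a * T)                      ≡⟨ sym (*-distribʳ-sum T λ a → w a * degree a) ⟩
      I * T                                               ∎)
      where
      swap : ∀ i h → i * (2 * h) ≡ h * (2 * i)
      swap = solve-∀
      pointwise : ∀ a → w a * 𝟙 (¬? (low? a)) * (2 * I) ≤ w a * degree a * T
      pointwise a with low? a
      ... | yes _ rewrite *-zeroʳ (w a) = z≤n
      ... | no gt rewrite *-identityʳ (w a) | *-assoc (w a) (degree a) T = *-monoʳ-≤ (w a) (<⇒≤ (≰⇒> gt))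

  -- A maximal independent set of low elements dominates them all, hence weight at least T/2, while
  -- each of its members dominates at most 2I/T.
  large-independent : 1 ≤ I → ∃[ S ] (AllPairs (λ a b → ¬ b ~ a) S × T * T ≤ 4 * (I * length S))
  large-independent I>0 with maximal-independent {_~_ = _~_} _~?_ ~-refl (filter low? (allFin M))
  ... | S , ind , sub , _ , dom = S , ind , (begin
    T * T                             ≤⟨ *-monoˡ-≤ T (half-low I>0) ⟩
    2 * sum (λ a → w a * 𝟙 (low? a)) * T
      ≤⟨ *-monoˡ-≤ T (*-monoʳ-≤ 2 (sum-mono dominated)) ⟩
    2 * sum (λ a → Σˡ (λ s → w a * 𝟙 (s ~? a)) S) * T
      ≡⟨ cong (λ z → 2 * z * T) (sum-Σˡ (λ a s → w a * 𝟙 (s ~? a)) S) ⟩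
    2 * Σˡ degree S * T               ≡⟨ trans (*-assoc 2 (Σˡ degree S) T) (cong (2 *_) (*-distribʳ-Σˡ degree T S)) ⟩
    2 * Σˡ (λ s → degree s * T) S     ≤⟨ *-monoʳ-≤ 2 (Σˡ-All (sub (All.all-filter low? (allFin M)))) ⟩
    2 * (length S * (2 * I))          ≡⟨ regroup (length S) I ⟩
    4 * (I * length S)                ∎)
    where
    regroup : ∀ l i → 2 * (l * (2 * i)) ≡ 4 * (i * l)
    regroup = solve-∀
    dominated : ∀ a → w a * 𝟙 (low? a) ≤ Σˡ (λ s → w a * 𝟙 (s ~? a)) S
    dominated a with low? a
    ... | no _ rewrite *-zeroʳ (w a) = z≤n
    ... | yes low with dom (∈-filter⁺ low? (∈-allFin a) low)
    ...   | s , s∈ , s~a = ≤-trans (≤-reflexive (cong (w a *_) (sym (𝟙-yes (s ~? a) s~a))))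
                             (Σˡ-∈ (λ s → w a * 𝟙 (s ~? a)) s∈)

-- Multiplicative weights.

sum-single : ∀ {M} (f : Fin M → ℕ) b → sum (λ c → 𝟙 (c Fin.≟ b) * f c) ≡ f b
sum-single {suc M} f zero = trans (cong₂ _+_ (+-identityʳ (f zero)) (trans (sum-cong-≗ none) (trans (sum-const M 0) (*-zeroʳ M)))) (+-identityʳ _)
  where
  none : ∀ c → 𝟙 (suc c Fin.≟ zero) * f (suc c) ≡ 0
  none c = cong (_* f (suc c)) (𝟙-no (suc c Fin.≟ zero) λ ())
sum-single {suc M} f (suc b) = trans (sum-cong-≗ λ c → cong (_* f (suc c))
  (𝟙-cong (suc c Fin.≟ suc b) (c Fin.≟ b) Fin.suc-injective (cong suc))) (sum-single (f ∘ suc) b)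

-- A substitute for linear programming duality, by multiplicative weights: while some set b is
-- light, add b to the fractional packing w and double the weights of its points. The total
-- weight grows slowly, hence so does the load of every point, whose weight is 2 ^ load.
module MultiplicativeWeights {m n : ℕ} (v₀ : Fin n) (In : Fin m → Fin n → Set)
                             (in? : (b : Fin m) (v : Fin n) → Dec (In b v)) where
  open ≤-Reasoning

  load : (Fin m → ℕ) → Fin n → ℕ
  load w v = sum λ b → w b * 𝟙 (in? b v)

  mass : (Fin n → ℕ) → Fin m → ℕ
  mass μ b = sum λ v → μ v * 𝟙 (in? b v)

  Heavy : ℕ → (Fin n → ℕ) → Set
  Heavy a μ = 1 ≤ sum μ × ∀ b → sum μ ≤ a * mass μ b

  weight : (Fin m → ℕ) → Fin n → ℕ
  weight w v = 2 ^ load w v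

  add : Fin m → (Fin m → ℕ) → Fin m → ℕ
  add b w c = w c + 𝟙 (c Fin.≟ b)

  sum-add : ∀ b w → sum (add b w) ≡ suc (sum w)
  sum-add b w = begin-equality
    sum (add b w)                              ≡⟨ ∑-distrib-+ w _ ⟩
    sum w + sum (λ c → 𝟙 (c Fin.≟ b))          ≡⟨ cong (sum w +_) (trans (sum-cong-≗ λ c → sym (*-identityʳ (𝟙 (c Fin.≟ b)))) (sum-single (λ _ → 1) b)) ⟩
    sum w + 1                                  ≡⟨ +-comm (sum w) 1 ⟩
    suc (sum w)                                ∎

  load-add : ∀ b w v → load (add b w) v ≡ load w v + 𝟙 (in? b v)
  load-add b w v = begin-equality
    sum (λ c → (w c + 𝟙 (c Fin.≟ b)) * 𝟙 (in? c v))
      ≡⟨ sum-cong-≗ (λ c → *-distribʳ-+ (𝟙 (in? c v)) (w c) _) ⟩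
    sum (λ c → w c * 𝟙 (in? c v) + 𝟙 (c Fin.≟ b) * 𝟙 (in? c v))
      ≡⟨ ∑-distrib-+ (λ c → w c * 𝟙 (in? c v)) _ ⟩
    load w v + sum (λ c → 𝟙 (c Fin.≟ b) * 𝟙 (in? c v))
      ≡⟨ cong (load w v +_) (sum-single (λ c → 𝟙 (in? c v)) b) ⟩
    load w v + 𝟙 (in? b v) ∎

  weight-add : ∀ b w → sum (weight (add b w)) ≡ sum (weight w) + mass (weight w) b
  weight-add b w = trans (sum-cong-≗ pointwise) (∑-distrib-+ (weight w) λ v → weight w v * 𝟙 (in? b v))
    where
    pointwise : ∀ v → weight (add b w) v ≡ weight w v + weight w v * 𝟙 (in? b v)
    pointwise v rewrite load-add b w v with in? b v
    ... | no _ rewrite +-identityʳ (load w v) | *-zeroʳ (2 ^ load w v) = sym (+-identityʳ _)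
    ... | yes _ rewrite +-comm (load w v) 1 | *-identityʳ (2 ^ load w v) = cong (2 ^ load w v +_) (+-identityʳ _)

  -- Doubling the weights on a light set adds less than a fraction 1/a of the total, so each round
  -- multiplies the total by at most (a+1)/a.
  run : ∀ a j → ∃ (Heavy a) ⊎
    ∃[ w ] (sum w ≡ j × sum (weight w) * a ^ j ≤ n * suc a ^ j)
  run a zero = inj₂ ((λ _ → 0) , trans (sum-const m 0) (*-zeroʳ m) , ≤-reflexive (cong (_* 1)
    (trans (sum-cong-≗ {n} λ v → cong (2 ^_) (trans (sum-const m 0) (*-zeroʳ m))) (trans (sum-const n 1) (*-identityʳ n)))))
  run a (suc j) with run a j
  ... | inj₁ heavy = inj₁ heavy
  ... | inj₂ (w , total , bound) with Fin.any? (λ b → a * mass (weight w) b <? sum (weight w))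
  ...   | no none = inj₁ (weight w , ≤-trans (m^n>0 2 (load w v₀)) (term≤sum (weight w) v₀) , λ b → ≮⇒≥ λ lt → none (b , lt))
  ...   | yes (b , light) = inj₂ (add b w , trans (sum-add b w) (cong suc total) , (begin
    sum (weight (add b w)) * (a * a ^ j)       ≡⟨ cong (_* (a * a ^ j)) (weight-add b w) ⟩
    (W + mass (weight w) b) * (a * a ^ j)      ≡⟨ regroup W (mass (weight w) b) a (a ^ j) ⟩
    (a * W + a * mass (weight w) b) * a ^ j    ≤⟨ *-monoˡ-≤ (a ^ j) (+-monoʳ-≤ (a * W) (<⇒≤ light)) ⟩
    (a * W + W) * a ^ j                        ≡⟨ collect a W (a ^ j) ⟩
    suc a * (W * a ^ j)                        ≤⟨ *-monoʳ-≤ (suc a) bound ⟩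
    suc a * (n * suc a ^ j)                ≡⟨ swap (suc a) n (suc a ^ j) ⟩
    n * (suc a * suc a ^ j)                ∎))
    where
    W = sum (weight w)
    regroup : ∀ W x a p → (W + x) * (a * p) ≡ (a * W + a * x) * p
    regroup = solve-∀
    collect : ∀ a W p → (a * W + W) * p ≡ suc a * (W * p)
    collect = solve-∀
    swap : ∀ x y z → x * (y * z) ≡ y * (x * z)
    swap = solve-∀

  -- A converse of Bernoulli's inequality: (1 + 1/a)^j is at most 1 + 2j/a while 2j is at most a.
  growth : ∀ a j → 2 * j ≤ a → a * suc a ^ j ≤ (a + 2 * j) * a ^ j
  growth a zero    _  = ≤-reflexive (cong (_* 1) (sym (+-identityʳ a)))
  growth a (suc j) le = begin
    a * (suc a * suc a ^ j)               ≡⟨ swap a (suc a) (suc a ^ j) ⟩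
    suc a * (a * suc a ^ j)               ≤⟨ *-monoʳ-≤ (suc a) (growth a j 2j≤a) ⟩
    suc a * ((a + 2 * j) * a ^ j)         ≡⟨ expand a j (a ^ j) ⟩
    (a * a + a + 2 * j * a + 2 * j) * a ^ j ≤⟨ *-monoˡ-≤ (a ^ j) (+-monoʳ-≤ (a * a + a + 2 * j * a) 2j≤a) ⟩
    (a * a + a + 2 * j * a + a) * a ^ j   ≡⟨ factor a j (a ^ j) ⟩
    (a + 2 * suc j) * (a * a ^ j)         ∎
    where
    2j≤a : 2 * j ≤ a
    2j≤a = ≤-trans (*-monoʳ-≤ 2 (n≤1+n j)) le
    swap : ∀ x y z → x * (y * z) ≡ y * (x * z)
    swap = solve-∀
    expand : ∀ a j p → suc a * ((a + 2 * j) * p) ≡ (a * a + a + 2 * j * a + 2 * j) * p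
    expand = solve-∀
    factor : ∀ a j p → (a * a + a + 2 * j * a + a) * p ≡ (a + 2 * suc j) * (a * p)
    factor = solve-∀

  doubling : ∀ k → 1 ≤ k → suc (2 * k) ^ k ≤ 2 * (2 * k) ^ k
  doubling k k>0 = *-cancelˡ-≤ (2 * k) {{>-nonZero (*-mono-≤ {1} {2} (s≤s z≤n) k>0)}} (begin
    2 * k * suc (2 * k) ^ k           ≤⟨ growth (2 * k) k ≤-refl ⟩
    (2 * k + 2 * k) * (2 * k) ^ k     ≡⟨ regroup (2 * k) ((2 * k) ^ k) ⟩
    2 * k * (2 * (2 * k) ^ k)         ∎)
    where
    regroup : ∀ a p → (a + a) * p ≡ a * (2 * p)
    regroup = solve-∀

  n<2^n : ∀ n → n < 2 ^ n
  n<2^n zero    = s≤s z≤n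
  n<2^n (suc n) = begin-strict
    suc n              <⟨ s≤s (n<2^n n) ⟩
    1 + 2 ^ n          ≤⟨ +-monoˡ-≤ (2 ^ n) (m^n>0 2 n) ⟩
    2 ^ n + 2 ^ n      ≡⟨ cong (2 ^ n +_) (sym (+-identityʳ _)) ⟩
    2 ^ suc n          ∎

  -- With a = 2k, every k rounds at most double the total, so after kn rounds it is at most n * 2^n.
  -- This is below 2^(2n), while a load above 2n would alone exceed that.
  heavy-or-packing : ∀ k → 1 ≤ k → ∃ (Heavy (2 * k)) ⊎
    ∃[ w ] (sum w ≡ k * n × ∀ v → load w v ≤ 2 * n)
  heavy-or-packing k k>0 with run (2 * k) (k * n)
  ... | inj₁ heavy = inj₁ heavy
  ... | inj₂ (w , total , bound) = inj₂ (w , total , λ v → ≮⇒≥ λ lt → <-irrefl refl (begin-strict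
    2 ^ (2 * s)            <⟨ ^-monoʳ-< 2 (s≤s (s≤s z≤n)) lt ⟩
    2 ^ load w v           ≤⟨ term≤sum (weight w) v ⟩
    sum (weight w)         ≤⟨ total-weight ⟩
    s * 2 ^ s              ≤⟨ *-monoˡ-≤ (2 ^ s) (<⇒≤ (n<2^n s)) ⟩
    2 ^ s * 2 ^ s          ≡⟨ sym (^-distribˡ-+-* 2 s s) ⟩
    2 ^ (s + s)            ≡⟨ cong (λ z → 2 ^ (s + z)) (sym (+-identityʳ s)) ⟩
    2 ^ (2 * s)            ∎))
    where
    s = n
    a = 2 * k
    powers : ∀ k j → suc a ^ k ≤ 2 * a ^ k → suc a ^ (k * j) ≤ 2 ^ j * a ^ (k * j)
    powers k zero h rewrite *-zeroʳ k = ≤-refl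
    powers k (suc j) h rewrite *-suc k j | ^-distribˡ-+-* (suc a) k (k * j) | ^-distribˡ-+-* a k (k * j) =
      ≤-trans (*-mono-≤ h (powers k j h)) (≤-reflexive (regroup (a ^ k) (2 ^ j) (a ^ (k * j))))
      where
      regroup : ∀ x y z → (2 * x) * (y * z) ≡ 2 * y * (x * z)
      regroup = solve-∀
    total-weight : sum (weight w) ≤ s * 2 ^ s
    total-weight = *-cancelʳ-≤ _ _ (a ^ (k * s)) {{>-nonZero (m^n>0 a {{>-nonZero (*-mono-≤ {1} {2} (s≤s z≤n) k>0)}} (k * s))}} (begin
      sum (weight w) * a ^ (k * s)    ≤⟨ bound ⟩
      s * suc a ^ (k * s)             ≤⟨ *-monoʳ-≤ s (powers k s (doubling k k>0)) ⟩
      s * (2 ^ s * a ^ (k * s))       ≡⟨ sym (*-assoc s (2 ^ s) (a ^ (k * s))) ⟩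
      s * 2 ^ s * a ^ (k * s)         ∎)

-- Transversals and matchings of an antichain of balls.

-- Layer-cake: μ i ⊓ μ j counts the levels s with both s < μ i and s < μ j.
sum-links-min : ∀ {N} {Link : Fin N → Fin N → Set} (link? : ∀ i j → Dec (Link i j)) (c : ℕ) →
  (∀ {U : Fin N → Set} (u? : ∀ i → Dec (U i)) →
    sum₂ (λ i j → 𝟙 (link? i j ×-dec (u? i ×-dec u? j))) ≤ c * sum (λ i → 𝟙 (u? i))) →
  ∀ B (μ : Fin N → ℕ) → (∀ i → μ i ≤ B) →
  sum₂ (λ i j → 𝟙 (link? i j) * (μ i ⊓ μ j)) ≤ c * sum μ
sum-links-min {N} link? c sparse zero μ small = ≤-trans (sum₂-mono vanish) (≤-trans (≤-reflexive
  (trans (sum-cong-≗ {N} λ _ → trans (sum-const N 0) (*-zeroʳ N)) (trans (sum-const N 0) (*-zeroʳ N)))) z≤n)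
  where
  vanish : ∀ i j → 𝟙 (link? i j) * (μ i ⊓ μ j) ≤ 0
  vanish i j = ≤-trans (*-monoʳ-≤ (𝟙 (link? i j)) (≤-trans (m⊓n≤m (μ i) (μ j)) (small i))) (≤-reflexive (*-zeroʳ (𝟙 (link? i j))))
sum-links-min {N} link? c sparse (suc B) μ small = begin
  sum₂ (λ i j → 𝟙 (link? i j) * (μ i ⊓ μ j))
    ≤⟨ sum₂-mono peel ⟩
  sum₂ (λ i j → bottom i j + rest i j)
    ≡⟨ sum₂-distrib-+ bottom rest ⟩
  sum₂ bottom + sum₂ rest
    ≤⟨ +-mono-≤ (sparse positive?) (sum-links-min link? c sparse B (λ i → μ i ∸ 1) λ i → ∸-monoˡ-≤ 1 (small i)) ⟩
  c * sum (λ i → 𝟙 (positive? i)) + c * sum (λ i → μ i ∸ 1)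
    ≡⟨ sym (*-distribˡ-+ c (sum λ i → 𝟙 (positive? i)) _) ⟩
  c * (sum (λ i → 𝟙 (positive? i)) + sum (λ i → μ i ∸ 1))
    ≡⟨ cong (c *_) (sym (trans (sum-cong-≗ split) (∑-distrib-+ (λ i → 𝟙 (positive? i)) λ i → μ i ∸ 1))) ⟩
  c * sum μ ∎
  where
  open ≤-Reasoning
  positive? : ∀ i → Dec (1 ≤ μ i)
  positive? i = 1 ≤? μ i
  bottom rest : Fin N → Fin N → ℕ
  bottom i j = 𝟙 (link? i j ×-dec (positive? i ×-dec positive? j))
  rest i j = 𝟙 (link? i j) * ((μ i ∸ 1) ⊓ (μ j ∸ 1))
  split : ∀ i → μ i ≡ 𝟙 (positive? i) + (μ i ∸ 1)
  split i with μ i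
  ... | zero  = refl
  ... | suc _ = refl
  peel : ∀ i j → 𝟙 (link? i j) * (μ i ⊓ μ j) ≤ bottom i j + rest i j
  peel i j rewrite 𝟙-× (link? i j) (positive? i ×-dec positive? j) | 𝟙-× (positive? i) (positive? j)
    with μ i | μ j
  ... | zero  | _     = ≤-trans (≤-reflexive (*-zeroʳ (𝟙 (link? i j)))) z≤n
  ... | suc _ | zero  = ≤-trans (≤-reflexive (*-zeroʳ (𝟙 (link? i j)))) z≤n
  ... | suc x | suc y = ≤-reflexive (trans (*-suc (𝟙 (link? i j)) (x ⊓ y))
    (cong (_+ 𝟙 (link? i j) * (x ⊓ y)) (sym (*-identityʳ (𝟙 (link? i j))))))

length-concatMap : ∀ {A B : Set} (f : A → List B) k → (∀ a → length (f a) ≡ k) → ∀ S →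
  length (concatMap f S) ≡ length S * k
length-concatMap f k h []      = refl
length-concatMap f k h (s ∷ S) = trans (List.length-++ (f s)) (cong₂ _+_ (h s) (length-concatMap f k h S))

module BallFamily (G : Graph) (adj? : (u v : Fin (Graph.n G)) → Dec (Graph.Adj G u v))
                  (t : ℕ) (minorFree : ¬ HasMinorK G t) (R : ℕ)
                  {m : ℕ} (c : Fin m → Fin (Graph.n G)) (r : Fin m → ℕ) (r≤R : (b : Fin m) → r b ≤ R)
                  (antichain : (a b : Fin m) →
                    ((v : Fin (Graph.n G)) → Distance.d G adj? R v (c a) ≤ r a → Distance.d G adj? R v (c b) ≤ r b) →
                    a ≡ b)
                  where
  open Graph G using (n)
  open Distance G adj? R
  open Exclusivity using (FewExclusivePairs)
  open ≤-Reasoning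

  Ball : Fin m → Fin n → Set
  Ball b v = d v (c b) ≤ r b

  ball? : ∀ b v → Dec (Ball b v)
  ball? b v = _ ≤? _

  centre-∈ : ∀ b → Ball b (c b)
  centre-∈ b = ≤-trans (≤-reflexive (d-self (c b))) z≤n

  -- The additive weights `R ∸ r b` turn balls of different radii into the single threshold `R`.
  weighted⁺ : ∀ {b v} → Ball b v → d v (c b) + (R ∸ r b) ≤ R
  weighted⁺ {b} le = ≤-trans (+-monoˡ-≤ (R ∸ r b) le) (≤-reflexive (m+[n∸m]≡n (r≤R b)))

  weighted⁻ : ∀ {b v} → d v (c b) + (R ∸ r b) ≤ R → Ball b v
  weighted⁻ {b} le = +-cancelʳ-≤ (R ∸ r b) _ _ (≤-trans le (≤-reflexive (sym (m+[n∸m]≡n (r≤R b)))))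

  undominated : ∀ a b → d (c a) (c b) + (R ∸ r b) ≤ R ∸ r a → a ≡ b
  undominated a b dom = antichain a b λ v va → weighted⁻ (begin
    d v (c b) + (R ∸ r b)                    ≤⟨ +-monoˡ-≤ (R ∸ r b) (d-triangle v (c a) (c b)) ⟩
    d v (c a) + d (c a) (c b) + (R ∸ r b)    ≡⟨ +-assoc (d v (c a)) _ _ ⟩
    d v (c a) + (d (c a) (c b) + (R ∸ r b))  ≤⟨ +-mono-≤ va dom ⟩
    r a + (R ∸ r a)                          ≡⟨ m+[n∸m]≡n (r≤R a) ⟩
    R                                        ∎)

  K : ℕ
  K = 2 * density t + 1

  few-ball-pairs : FewExclusivePairs (λ v b → Ball b v) (λ v b → ball? b v) K
  few-ball-pairs = SiteQueries.few-exclusive-pairs G adj? t minorFree R c (λ b → R ∸ r b) id (λ _ → R) (λ _ → ≤-refl)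
    (λ v b → Ball b v) (λ v b → ball? b v) (λ _ _ → weighted⁺) (λ _ _ → weighted⁻) undominated

  few-vertex-pairs : FewExclusivePairs Ball ball? K
  few-vertex-pairs = SiteQueries.few-exclusive-pairs G adj? t minorFree R id (λ _ → 0) c r r≤R
    Ball ball? (λ b v → subst (_≤ r b) (same b v)) (λ b v → subst (_≤ r b) (sym (same b v)))
    λ u v le → d≡0 (subst (_≤ 0) (+-identityʳ _) le)
    where
    same : ∀ b v → d v (c b) ≡ d (c b) v + 0
    same b v = trans (d-sym v (c b)) (sym (+-identityʳ _))

  -- Large enough that overlaps of relative size at most 1/ρ along links add up to at most half of
  -- the total mass in `total≤2`.
  ρ : ℕ
  ρ = 2 * K

  netSize : ℕ
  netSize = 2 + K * (ρ * ρ)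

  module _ (μ : Fin n → ℕ) (μ>0 : 1 ≤ sum μ) (A : ℕ)
           (heavy : (b : Fin m) → sum μ ≤ A * sum (λ v → μ v * 𝟙 (ball? b v))) where

    mass : Fin m → ℕ
    mass b = sum λ v → μ v * 𝟙 (ball? b v)

    shared : Fin m → Fin m → ℕ
    shared a b = sum λ v → μ v * 𝟙 (ball? a v) * 𝟙 (ball? b v)

    shared-sym : ∀ a b → shared a b ≡ shared b a
    shared-sym a b = sum-cong-≗ λ v → swap (μ v) (𝟙 (ball? a v)) (𝟙 (ball? b v))
      where
      swap : ∀ x y z → x * y * z ≡ x * z * y
      swap = solve-∀

    shared-self : ∀ a → shared a a ≡ mass a
    shared-self a = sum-cong-≗ λ v → trans (*-assoc (μ v) _ _) (cong (μ v *_) (idem (ball? a v)))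
      where
      idem : {P : Set} (p : Dec P) → 𝟙 p * 𝟙 p ≡ 𝟙 p
      idem (yes _) = refl
      idem (no _)  = refl

    mass>0 : ∀ b → 1 ≤ mass b
    mass>0 b = n≢0⇒n>0 λ eq → <⇒≱ μ>0 (≤-trans (heavy b) (≤-reflexive (trans (cong (A *_) eq) (*-zeroʳ A))))

    -- Ball `b` takes more than a fraction 1/ρ of the measure of `a`, so a net for the measure
    -- restricted to `a` must hit `b`.
    Covers : Fin m → Fin m → Set
    Covers a b = mass a < ρ * shared a b

    covers? : ∀ a b → Dec (Covers a b)
    covers? a b = _ <? _

    covers-self : ∀ a → Covers a a
    covers-self a rewrite shared-self a = begin-strict
      mass a          <⟨ m<m+n (mass a) (mass>0 a) ⟩
      mass a + mass a ≡⟨ cong (mass a +_) (sym (+-identityʳ _)) ⟩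
      2 * mass a      ≤⟨ *-monoˡ-≤ (mass a) (*-monoʳ-≤ 2 (m≤n+m 1 (2 * density t))) ⟩
      ρ * mass a      ∎

    local-net : ∀ a → ∃[ p ] ∀ b → Covers a b → ∃[ i ] Ball b (lookup {n = netSize} p i)
    local-net a = Sampling.net (λ v → μ v * 𝟙 (ball? a v)) Ball ball? K few-vertex-pairs (mass>0 a) ρ

    -- Decreasing order, because `maximal-independent` selects from the end: small balls are chosen
    -- first.
    bigger-first = Sort.sort (Flip.decTotalOrder (On.decTotalOrder ≤-decTotalOrder mass)) (allFin m)

    bigger-first-sorted : AllPairs (λ a b → mass b ≤ mass a) bigger-first
    bigger-first-sorted = Linked⇒AllPairs (λ p q → ≤-trans q p)
      (Sort.sort-↗ (Flip.decTotalOrder (On.decTotalOrder ≤-decTotalOrder mass)) (allFin m))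

    Separate : Fin m → Fin m → Set
    Separate a b = ¬ a ≡ b × ρ * shared a b ≤ mass a ⊓ mass b

    separate-sym : ∀ {a b} → Separate a b → Separate b a
    separate-sym {a} {b} (ne , le) = ne ∘ sym ,
      subst₂ (λ x y → ρ * x ≤ y) (shared-sym a b) (⊓-comm (mass a) (mass b)) le

    separate-cover : ∃[ S ] (AllPairs Separate S × ∀ b → ∃[ s ] (s ∈ S × Covers s b))
    separate-cover with maximal-independent {_~_ = Covers} covers? covers-self bigger-first
    ... | S , ind , _ , sub₂ , dom = S ,
      -- Of two chosen balls the later, `b`, has the smaller mass, so its failure to cover `a`
      -- bounds the overlap by the minimum of both masses.
      AllPairs.zipWith (λ {a} {b} (ba , ¬cov) →
          (λ { refl → ¬cov (covers-self a) }) ,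
          subst (λ z → ρ * z ≤ mass a ⊓ mass b) (shared-sym b a)
            (≤-trans (≮⇒≥ ¬cov) (⊓-glb ba ≤-refl)))
        (sub₂ bigger-first-sorted , ind) ,
      λ b → dom (↭.∈-resp-↭ (↭.↭-sym (Sort.sort-↭ _ (allFin m))) (∈-allFin b))

    module _ (S : List (Fin m)) (separate : AllPairs Separate S) where
      p : Fin (length S) → Fin m
      p = List.lookup S

      open Voronoi G adj? t minorFree R (c ∘ p) (λ i → R ∸ r (p i))

      all-centred : ∀ i → Centred i
      all-centred i = decidable-stable (cell? i (c (p i))) λ ¬c →
        let k , k≢i , dom = uncentred (m∸n≤m R (r (p i))) ¬c
        in proj₁ (allPairs-lookup separate-sym separate i k (k≢i ∘ sym)) (undominated (p i) (p k) dom)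

      near : Fin n → Fin (length S) → ℕ
      near v i = 𝟙 (kd v i ≤? R)

      near≡ : ∀ v i → near v i ≡ 𝟙 (ball? (p i) v)
      near≡ v i = 𝟙-cong (kd v i ≤? R) (ball? (p i) v) weighted⁻ weighted⁺

      total : ℕ
      total = sum λ i → mass (p i)

      -- Each vertex counts once per chosen ball containing it, hence at most once plus the links
      -- among those balls; summed over vertices, each link contributes its overlap.
      total≤ : total ≤ sum μ + sum₂ (λ i j → 𝟙 (link? i j) * shared (p i) (p j))
      total≤ = begin
        sum₂ (λ i v → μ v * 𝟙 (ball? (p i) v))
          ≡⟨ sum-cong-≗ (λ i → sum-cong-≗ λ v → cong (μ v *_) (sym (near≡ v i))) ⟩
        sum₂ (λ i v → μ v * near v i)
          ≡⟨ ∑-comm (λ i v → μ v * near v i) ⟩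
        sum₂ (λ v i → μ v * near v i)
          ≡⟨ sum-cong-≗ (λ v → sym (*-distribˡ-sum (μ v) (near v))) ⟩
        sum (λ v → μ v * sum (near v))
          ≤⟨ sum-mono (λ v → *-monoʳ-≤ (μ v) (covering-links all-centred v)) ⟩
        sum (λ v → μ v * (1 + sum₂ (near-links v)))
          ≡⟨ sum-cong-≗ (λ v → trans (*-suc (μ v) _) (cong (μ v +_) (*-distribˡ-sum₂ (μ v) (near-links v)))) ⟩
        sum (λ v → μ v + sum₂ (λ i j → μ v * near-links v i j))
          ≡⟨ ∑-distrib-+ μ (λ v → sum₂ λ i j → μ v * near-links v i j) ⟩
        sum μ + sum (λ v → sum₂ λ i j → μ v * near-links v i j)
          ≡⟨ cong (sum μ +_) (trans (∑-comm λ v i → sum λ j → μ v * near-links v i j)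
               (sum-cong-≗ λ i → ∑-comm λ v j → μ v * near-links v i j)) ⟩
        sum μ + sum₂ (λ i j → sum λ v → μ v * near-links v i j)
          ≡⟨ cong (sum μ +_) (sum-cong-≗ λ i → sum-cong-≗ λ j →
               trans (sum-cong-≗ (pull i j)) (sym (*-distribˡ-sum (𝟙 (link? i j)) λ v → μ v * 𝟙 (ball? (p i) v) * 𝟙 (ball? (p j) v)))) ⟩
        sum μ + sum₂ (λ i j → 𝟙 (link? i j) * shared (p i) (p j)) ∎
        where
        near-links : Fin n → Fin (length S) → Fin (length S) → ℕ
        near-links v i j = 𝟙 (link? i j ×-dec ((kd v i ≤? R) ×-dec (kd v j ≤? R)))
        pull : ∀ i j v → μ v * near-links v i j ≡ 𝟙 (link? i j) * (μ v * 𝟙 (ball? (p i) v) * 𝟙 (ball? (p j) v))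
        pull i j v = trans
          (cong (μ v *_) (trans (𝟙-× (link? i j) ((kd v i ≤? R) ×-dec (kd v j ≤? R)))
            (cong (𝟙 (link? i j) *_) (trans (𝟙-× (kd v i ≤? R) (kd v j ≤? R)) (cong₂ _*_ (near≡ v i) (near≡ v j))))))
          (rearrange (μ v) (𝟙 (link? i j)) (𝟙 (ball? (p i) v)) (𝟙 (ball? (p j) v)))
          where
          rearrange : ∀ x l a b → x * (l * (a * b)) ≡ l * (x * a * b)
          rearrange = solve-∀

      -- Separation bounds each overlap by the smaller mass over `ρ`, and the layer-cake estimate
      -- sums these minima over links to at most `K * total`. Half of the total is thus absorbed.
      total≤2 : total ≤ 2 * sum μ
      total≤2 = *-cancelˡ-≤ K {{>-nonZero (m≤n+m 1 (2 * density t))}} (+-cancelʳ-≤ (K * total) _ _ (begin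
        K * total + K * total        ≡⟨ double K total ⟩
        ρ * total                    ≤⟨ *-monoʳ-≤ ρ total≤ ⟩
        ρ * (sum μ + sum₂ (λ i j → 𝟙 (link? i j) * shared (p i) (p j)))
          ≡⟨ trans (*-distribˡ-+ ρ (sum μ) _) (cong (ρ * sum μ +_)
               (trans (*-distribˡ-sum₂ ρ λ i j → 𝟙 (link? i j) * shared (p i) (p j))
                 (sum-cong-≗ λ i → sum-cong-≗ λ j → swap ρ (𝟙 (link? i j)) (shared (p i) (p j))))) ⟩
        ρ * sum μ + sum₂ (λ i j → 𝟙 (link? i j) * (ρ * shared (p i) (p j)))
          ≤⟨ +-monoʳ-≤ (ρ * sum μ) (sum₂-mono small) ⟩
        ρ * sum μ + sum₂ (λ i j → 𝟙 (link? i j) * (mass (p i) ⊓ mass (p j)))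
          ≤⟨ +-monoʳ-≤ (ρ * sum μ) (sum-links-min link? (2 * density t) links-sparse total (λ i → mass (p i)) (term≤sum λ i → mass (p i))) ⟩
        ρ * sum μ + 2 * density t * total
          ≤⟨ +-monoʳ-≤ (ρ * sum μ) (*-monoˡ-≤ total (m≤m+n (2 * density t) 1)) ⟩
        ρ * sum μ + K * total        ≡⟨ cong (_+ K * total) (regroup K (sum μ)) ⟩
        K * (2 * sum μ) + K * total  ∎))
        where
        double : ∀ k x → k * x + k * x ≡ 2 * k * x
        double = solve-∀
        regroup : ∀ k x → 2 * k * x ≡ k * (2 * x)
        regroup = solve-∀
        swap : ∀ x y z → x * (y * z) ≡ y * (x * z)
        swap = solve-∀
        small : ∀ i j → 𝟙 (link? i j) * (ρ * shared (p i) (p j)) ≤ 𝟙 (link? i j) * (mass (p i) ⊓ mass (p j))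
        small i j with link? i j
        ... | no _            = z≤n
        ... | yes (i≢j , _) = +-monoˡ-≤ 0 (proj₂ (allPairs-lookup separate-sym separate i j i≢j))

      length≤ : length S ≤ 2 * A
      length≤ = *-cancelʳ-≤ (length S) (2 * A) (sum μ) {{>-nonZero μ>0}} (begin
        length S * sum μ                  ≡⟨ sym (sum-const (length S) (sum μ)) ⟩
        sum {length S} (λ _ → sum μ)      ≤⟨ sum-mono (λ i → heavy (p i)) ⟩
        sum (λ i → A * mass (p i))        ≡⟨ sym (*-distribˡ-sum A λ i → mass (p i)) ⟩
        A * total                         ≤⟨ *-monoʳ-≤ A total≤2 ⟩
        A * (2 * sum μ)                   ≡⟨ regroup A (sum μ) ⟩
        2 * A * sum μ                     ∎)
        where
        regroup : ∀ a x → a * (2 * x) ≡ 2 * a * x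
        regroup = solve-∀

    small-transversal : ∃[ P ] (length P ≤ 2 * A * netSize × ∀ b → ∃[ v ] (v ∈ P × Ball b v))
    small-transversal with separate-cover
    ... | S , separate , cover = concatMap points S ,
      ≤-trans (≤-reflexive (length-concatMap points netSize (λ a → List.length-tabulate (lookup (proj₁ (local-net a)))) S))
        (*-monoˡ-≤ netSize (length≤ S separate)) ,
      λ b → let s , s∈ , cov = cover b
                i , bi = proj₂ (local-net s) b cov
            in lookup (proj₁ (local-net s)) i , ∈-concatMap⁺ points (lose s∈ (∈-tabulate⁺ {f = lookup (proj₁ (local-net s))} i)) , bi
      where
      points : Fin m → List (Fin n)
      points a = tabulate (lookup (proj₁ (local-net a)))

  -- Two random balls then meet with probability at most 1/(4(ν+1)), which is what the Turán bound
  -- needs for ν+1 disjoint balls.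
  samples : ℕ → ℕ
  samples ν = suc (8 * K * suc ν)

  large-matching : ∀ ν L (w : Fin m → ℕ) → 1 ≤ sum w → (∀ v → sum (λ b → w b * 𝟙 (ball? b v)) ≤ L) →
    2 * (samples ν * L) ≤ sum w →
    ∃[ S ] (AllPairs (λ a b → ¬ (∃[ v ] (Ball b v × Ball a v))) S × ν < length S)
  large-matching ν L w w>0 load large =
    let S , ind , T²≤ = large-independent I>0 in
    S , ind , *-cancelˡ-≤ (8 * K * I) {{>-nonZero (*-mono-≤ 8K>0 I>0)}} (begin
      8 * K * I * suc ν              ≡⟨ swap (8 * K) I (suc ν) ⟩
      8 * K * suc ν * I              ≤⟨ few-meetings ⟩
      2 * K * (sum w * sum w)        ≤⟨ *-monoʳ-≤ (2 * K) T²≤ ⟩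
      2 * K * (4 * (I * length S))   ≡⟨ regroup K I (length S) ⟩
      8 * K * I * length S           ∎)
    where
    open Sampling w using (meeting; Meet; meet?; meeting-bound)
    In : Fin n → Fin m → Set
    In v b = Ball b v
    in? : ∀ v b → Dec (In v b)
    in? v b = ball? b v
    open WeightedTurán w (Meet In in? K few-ball-pairs w>0) (meet? In in? K few-ball-pairs w>0)
      (λ b → c b , centre-∈ b , centre-∈ b)
    8K>0 : 1 ≤ 8 * K
    8K>0 = *-mono-≤ {1} {8} (s≤s z≤n) (m≤n+m 1 (2 * density t))
    I>0 : 1 ≤ I
    I>0 = let b , wb = sum-positive w>0 in begin
      1                   ≤⟨ *-mono-≤ wb (*-mono-≤ wb (≤-reflexive (sym (𝟙-yes (meet? In in? K few-ball-pairs w>0 b b) (c b , centre-∈ b , centre-∈ b))))) ⟩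
      w b * (w b * 𝟙 (meet? In in? K few-ball-pairs w>0 b b))
                          ≤⟨ *-monoʳ-≤ (w b) (term≤sum (λ a → w a * 𝟙 (meet? In in? K few-ball-pairs w>0 b a)) b) ⟩
      w b * degree b      ≤⟨ term≤sum (λ a → w a * degree a) b ⟩
      I                   ∎
    I≡meeting : meeting In in? K few-ball-pairs w>0 ≡ I
    I≡meeting = sum-cong-≗ λ a → sym (*-distribˡ-sum (w a) λ b → w b * 𝟙 (meet? In in? K few-ball-pairs w>0 a b))
    few-meetings : 8 * K * suc ν * I ≤ 2 * K * (sum w * sum w)
    few-meetings = +-cancelˡ-≤ I _ _ (subst (λ z → samples ν * z ≤ z + 2 * K * (sum w * sum w)) I≡meeting
      (meeting-bound In in? K few-ball-pairs w>0 L (8 * K * suc ν) load large))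
    swap : ∀ k i v → k * i * v ≡ k * v * i
    swap = solve-∀
    regroup : ∀ k i l → 2 * k * (4 * (i * l)) ≡ 8 * k * i * l
    regroup = solve-∀

  matching-or-transversal : ∀ ν → Fin n →
    (∃[ S ] (AllPairs (λ a b → ¬ (∃[ v ] (Ball b v × Ball a v))) S × ν < length S)) ⊎
    (∃[ P ] (length P ≤ 2 * (2 * (4 * samples ν)) * netSize × ∀ b → ∃[ v ] (v ∈ P × Ball b v)))
  -- A packing of total `4 * samples ν * n` with load at most `2 * n` satisfies the requirement of
  -- `large-matching` with equality.
  matching-or-transversal ν v₀ with MultiplicativeWeights.heavy-or-packing v₀ Ball ball? (4 * samples ν) (s≤s z≤n)
  ... | inj₁ (μ , μ>0 , heavy) = inj₂ (small-transversal μ μ>0 (2 * (4 * samples ν)) heavy)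
  ... | inj₂ (w , total , load) = inj₁ (large-matching ν (2 * n) w
    (subst (1 ≤_) (sym total) (*-mono-≤ {1} {4 * samples ν} (s≤s z≤n) (nonempty v₀)))
    load
    (≤-reflexive (trans (regroup (samples ν) n) (sym total))))
    where
    nonempty : ∀ {n} → Fin n → 1 ≤ n
    nonempty zero    = s≤s z≤n
    nonempty (suc _) = s≤s z≤n
    regroup : ∀ s n → 2 * (s * (2 * n)) ≡ 4 * s * n
    regroup = solve-∀

-- Reduction to minimal edges, and the conclusion.

-- Hitting the minimal edges hits all edges, and a matching of minimal edges is a matching. Of edges
-- that are equal as sets only one is kept.
minimal-elements : ∀ {B : Set} {_⊑_ : B → B → Set} → (∀ a b → Dec (a ⊑ b)) →
  (∀ a → a ⊑ a) → (∀ {a b c} → a ⊑ b → b ⊑ c → a ⊑ c) → (l : List B) →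
  ∃[ S ] (AllPairs (λ a b → ¬ a ⊑ b × ¬ b ⊑ a) S × (∀ {b} → b ∈ l → ∃[ s ] (s ∈ S × s ⊑ b)))
minimal-elements _⊑?_ rfl trns []      = [] , [] , λ ()
minimal-elements {_⊑_ = _⊑_} _⊑?_ rfl trns (a ∷ l) with minimal-elements {_⊑_ = _⊑_} _⊑?_ rfl trns l
... | S , anti , below with Any.any? (_⊑? a) S
...   | yes s⊑a = S , anti , λ { (here refl) → find s⊑a ; (there b∈) → below b∈ }
...   | no ¬s⊑a = a ∷ filter above? S ,
  All.zip (All.all-filter above? S , All.filter⁺ above? (All.¬Any⇒All¬ S ¬s⊑a)) ∷ AllPairs.filter⁺ above? anti ,
  λ { (here refl) → a , here refl , rfl a ; (there b∈) → descend (below b∈) }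
  where
  above? : ∀ s → Dec (¬ a ⊑ s)
  above? s = ¬? (a ⊑? s)
  descend : ∀ {b} → ∃[ s ] (s ∈ S × s ⊑ b) → ∃[ s ] (s ∈ a ∷ filter above? S × s ⊑ b)
  descend (s , s∈ , s⊑b) with a ⊑? s
  ... | yes a⊑s = a , here refl , trns a⊑s s⊑b
  ... | no a⋢s  = s , there (∈-filter⁺ above? s∈ a⋢s) , s⊑b

¬¬-Π : ∀ {n} {P : Fin n → Set} → (∀ i → ¬ ¬ P i) → ¬ ¬ (∀ i → P i)
¬¬-Π {zero}  h k = k λ ()
¬¬-Π {suc n} h k = h zero λ p₀ → ¬¬-Π (h ∘ suc) λ ps → k λ { zero → p₀ ; (suc i) → ps i }

-- The 16 collects the factors of `matching-or-transversal`, the middle factor bounds `samples ν` by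
-- a multiple of a positive ν, and the last is `netSize`.
constant : ℕ → ℕ
constant t = 16 * (1 + 16 * K) * (2 + K * (2 * K * (2 * K)))
  where K = 2 * density t + 1

module _ (t : ℕ) (G : Graph) (minorFree : ¬ HasMinorK G t) (H : BallHypergraph G)
         (adj? : (u v : Fin (Graph.n G)) → Dec (Graph.Adj G u v)) where
  open Graph G using (n)
  open BallHypergraph H

  R : ℕ
  R = sum radius

  open Distance G adj? R

  Edge : Fin m → Fin n → Set
  Edge k v = d v (centre k) ≤ radius k

  edge⇒ : ∀ {k v} → Edge k v → _∈E_ H v k
  edge⇒ {k} = distLe (term≤sum radius k)

  _⊑_ : Fin m → Fin m → Set
  a ⊑ b = ∀ v → Edge a v → Edge b v

  minimal : ∃[ S ] (AllPairs (λ a b → ¬ a ⊑ b × ¬ b ⊑ a) S × (∀ {b} → b ∈ allFin m → ∃[ s ] (s ∈ S × s ⊑ b)))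
  minimal = minimal-elements {_⊑_ = _⊑_}
    (λ a b → Fin.all? λ v → (d v (centre a) ≤? radius a) →-dec (d v (centre b) ≤? radius b))
    (λ a v va → va) (λ f g v va → g v (f v va)) (allFin m)

  S : List (Fin m)
  S = proj₁ minimal

  s : Fin (length S) → Fin m
  s = List.lookup S

  s-antichain : ∀ i j → s i ⊑ s j → i ≡ j
  s-antichain i j sub = decidable-stable (i Fin.≟ j) λ i≢j →
    proj₁ (allPairs-lookup (λ (p , q) → q , p) (proj₁ (proj₂ minimal)) i j i≢j) sub

  open BallFamily G adj? t minorFree R (centre ∘ s) (radius ∘ s) (λ i → term≤sum radius (s i)) s-antichain

  τ≤constant*ν : ∀ ν τ → IsNu H ν → IsTau H τ → τ ≤ constant t * ν
  -- Without edges the empty transversal gives τ = 0; an edge gives ν at least 1, which absorbs the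
  -- additive constants.
  τ≤constant*ν ν τ (_ , ν-max) (_ , τ-min) with Fin.any? {n = m} (λ _ → yes tt)
  ... | no empty = ≤-trans (τ-min [] λ k → ⊥-elim (empty (k , tt))) z≤n
  ... | yes (k , _) with matching-or-transversal ν (centre k)
  ...   | inj₁ (M , disjoint , larger) = contradiction
    (ν-max (List.map s M) (AllPairs.map⁺ (AllPairs.map (λ none v (va , vb) → none (v , d≤ vb , d≤ va)) disjoint)))
    (<⇒≱ (subst (ν <_) (sym (List.length-map s M)) larger))
  ...   | inj₂ (P , small , hits) = begin
    τ                                                  ≤⟨ τ-min P meets-edge ⟩
    length P                                           ≤⟨ small ⟩
    2 * (2 * (4 * samples ν)) * netSize                ≡⟨ cong (_* netSize) (regroup (samples ν)) ⟩
    16 * samples ν * netSize                           ≤⟨ *-monoˡ-≤ netSize (*-monoʳ-≤ 16 samples≤) ⟩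
    16 * ((1 + 16 * K) * ν) * netSize                  ≡⟨ rearrange (1 + 16 * K) ν netSize ⟩
    constant t * ν                                     ∎
    where
    open ≤-Reasoning
    regroup : ∀ x → 2 * (2 * (4 * x)) ≡ 16 * x
    regroup = solve-∀
    rearrange : ∀ x v z → 16 * (x * v) * z ≡ 16 * x * z * v
    rearrange = solve-∀
    ν>0 : 1 ≤ ν
    ν>0 = ν-max (k ∷ []) ([] ∷ [])
    meets-edge : IsTransversal H P
    meets-edge b with proj₂ (proj₂ minimal) (∈-allFin b)
    ... | a , a∈S , a⊑b =
      let v , v∈P , va = hits (Any.index a∈S)
      in v , v∈P , edge⇒ (a⊑b v (subst (λ z → Edge z v) (sym (Any.lookup-index a∈S)) va))
    samples≤ : samples ν ≤ (1 + 16 * K) * ν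
    samples≤ = begin
      1 + 8 * K * suc ν                ≡⟨ split K ν ⟩
      1 + 8 * K * ν + 8 * K * 1        ≤⟨ +-mono-≤ (+-monoˡ-≤ (8 * K * ν) ν>0) (*-monoʳ-≤ (8 * K) ν>0) ⟩
      ν + 8 * K * ν + 8 * K * ν        ≡⟨ collect K ν ⟩
      (1 + 16 * K) * ν                 ∎
      where
      split : ∀ k v → 1 + 8 * k * suc v ≡ 1 + 8 * k * v + 8 * k * 1
      split = solve-∀
      collect : ∀ k v → v + 8 * k * v + 8 * k * v ≡ (1 + 16 * k) * v
      collect = solve-∀

theorem1p2 : (t : ℕ) → 1 ≤ t → ∃[ c ] ((G : Graph) → ¬ HasMinorK G t →
    (H : BallHypergraph G) → (ν τ : ℕ) → IsNu H ν → IsTau H τ → τ ≤ c * ν)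
theorem1p2 t _ = constant t , λ G minorFree H ν τ isν isτ →
  -- Adjacency is an arbitrary relation on finitely many pairs. It may be assumed decidable under a
  -- double negation, which the decidable conclusion removes.
  decidable-stable (τ ≤? constant t * ν) λ ¬le →
    ¬¬-Π (λ u → ¬¬-Π λ v → ¬¬-excluded-middle) λ adj? →
      ¬le (τ≤constant*ν t G minorFree H adj? ν τ isν isτ)
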